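{- Let $G$ be a Class 1 graph with $\Delta(G)=4$ and let $t\geq 5$ be an integer. Then every proper $t$-edge coloring of $G$ can be transformed into any proper $4$-edge coloring of $G$ by a sequence of interchanges.
   Context: All graphs are finite, without loops and multiple edges. A proper $t$-edge coloring of $G$ is a map $f:E(G)\to\{1,\dots,t\}$ with $f(e)\neq f(e')$ for adjacent edges $e,e'$; a proper $4$-edge coloring is also regarded as a proper $t$-edge coloring for $t\ge4$. $\Delta(G)$ is the maximum degree, $\chi'(G)$ the chromatic index; $G$ is Class 1 if $\chi'(G)=\Delta(G)$. For a proper $t$-edge coloring $f$ and colors $a,b$, $G_f(a,b)$ is the subgraph induced by the edges colored $a$ or $b$; switching colors $a$ and $b$ on one connected component of $G_f(a,b)$ is an interchange, producing another proper $t$-edge coloring. -}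

module Defs where

open import Data.Nat using (ℕ; _≤_; _<_; _≥_; zero; suc)
open import Data.Fin using (Fin; _≟_)
open import Data.Product using (_×_; _,_; Σ; ∃; ∃-syntax; proj₁; proj₂)
open import Data.Sum using (_⊎_)
open import Data.List using (List; length; filter; allFin)
open import Relation.Nullary using (¬_; Dec; _×-dec_; _⊎-dec_)
open import Relation.Binary.PropositionalEquality using (_≡_; _≢_)
open import Relation.Binary.Construct.Closure.ReflexiveTransitive using (Star)

record Graph : Set where
  field
    n    : ℕ
    m    : ℕ
    src  : Fin m → Fin n
    tgt  : Fin m → Fin n
    loopless : ∀ e → src e ≢ tgt e
    simple   : ∀ e e' → ((src e ≡ src e' × tgt e ≡ tgt e') ⊎ (src e ≡ tgt e' × tgt e ≡ src e')) → e ≡ e'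

open Graph public

Incident : (G : Graph) → Fin (n G) → Fin (m G) → Set
Incident G v e = (src G e ≡ v) ⊎ (tgt G e ≡ v)

incident? : (G : Graph) → (v : Fin (n G)) → (e : Fin (m G)) → Dec (Incident G v e)
incident? G v e = (src G e ≟ v) ⊎-dec (tgt G e ≟ v)

degree : (G : Graph) → Fin (n G) → ℕ
degree G v = length (filter (incident? G v) (allFin (m G)))

MaxDegree : Graph → ℕ → Set
MaxDegree G d = (∀ v → degree G v ≤ d) × (∃[ v ] degree G v ≡ d)

Adjacent : (G : Graph) → Fin (m G) → Fin (m G) → Set
Adjacent G e e' = e ≢ e' × ∃[ v ] (Incident G v e × Incident G v e')

Colouring : Graph → Set
Colouring G = Fin (m G) → ℕ

ProperEdgeColouring : (G : Graph) → ℕ → Colouring G → Set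
ProperEdgeColouring G t f =
  (∀ e → 1 ≤ f e × f e ≤ t) × (∀ e e' → Adjacent G e e' → f e ≢ f e')

Colourable : Graph → ℕ → Set
Colourable G t = ∃[ f ] ProperEdgeColouring G t f

ChromaticIndex : Graph → ℕ → Set
ChromaticIndex G k = Colourable G k × (∀ j → Colourable G j → k ≤ j)

Class1 : Graph → Set
Class1 G = ∃[ d ] (MaxDegree G d × ChromaticIndex G d)

InAB : ℕ → ℕ → ℕ → Set
InAB a b c = c ≡ a ⊎ c ≡ b

-- e lies in the connected component of G_f(a,b) containing the edge e₀
-- (components of an edge-induced subgraph are determined by its edges)
data SameComponent (G : Graph) (f : Colouring G) (a b : ℕ) (e₀ : Fin (m G)) : Fin (m G) → Set where
  here : InAB a b (f e₀) → SameComponent G f a b e₀ e₀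
  step : ∀ {e e'} → SameComponent G f a b e₀ e → Adjacent G e e' → InAB a b (f e') →
         SameComponent G f a b e₀ e'

swapAB : ℕ → ℕ → ℕ → ℕ → Set
swapAB a b c c' = (c ≡ a × c' ≡ b) ⊎ (c ≡ b × c' ≡ a)

Interchange : (G : Graph) → ℕ → Colouring G → Colouring G → Set
Interchange G t f g =
  ∃[ a ] ∃[ b ] ∃[ e₀ ]
    (1 ≤ a × a ≤ t × 1 ≤ b × b ≤ t × a ≢ b × InAB a b (f e₀) ×
     (∀ e → (SameComponent G f a b e₀ e → swapAB a b (f e) (g e))
          × (¬ SameComponent G f a b e₀ e → g e ≡ f e)))

Transformable : (G : Graph) → ℕ → Colouring G → Colouring G → Set
Transformable G t f g = ∃[ h ] (Star (Interchange G t) f h × (∀ e → h e ≡ g e))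

-- The colour classes of g are installed one after the other; an installed class c is frozen, and only
-- the remaining colours are interchanged afterwards. Call the edges of class c of g targets. A target
-- uv not yet coloured c is recoloured with c as soon as both its ends miss c.
--
-- Where every vertex misses a colour other than c, a Vizing fan removes colour c from any given edge.
-- Counting the g-colours at a vertex shows that this is so if t ≥ 6, and for t = 5 unless a vertex u
-- missing c has a target edge uv of another colour a. In that case let vw have colour c, let v miss α
-- and w miss β. Unless uv can be given colour c at once, the neighbour p of w along colour a misses a
-- fourth colour δ, and Kempe chains join w to v and to p. So c, a, α, β, δ are all the colours, w has
-- an edge of each of the colours c, a, α, δ, and, g having four colours, one of these four edges is a
-- target. In each of the resulting cases the two chains allow the vertex at the other end of a c-edge
-- to exchange its missing colour until an explicit interchange gives uv colour c.
module Submission where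

open import Defs
open import Data.Nat using (ℕ; zero; suc; _≤_; _<_; _≥_; z≤n; s≤s)
import Data.Nat as ℕ
import Data.Nat.Properties as ℕₚ
open import Data.Fin using (Fin; _≟_)
open import Data.Fin.Properties using (any?; all?)
open import Data.Product using (_×_; _,_; ∃; ∃₂; proj₁; proj₂)
open import Data.Sum using (_⊎_; inj₁; inj₂; [_,_]′; swap)
import Data.Sum as Sum
open import Data.Empty using (⊥; ⊥-elim)
open import Data.List using (List; []; _∷_; length; filter; allFin; map; upTo)
open import Data.List.Properties using (filter-notAll; length-map; length-upTo)
open import Data.List.Membership.Propositional using (_∈_; _∉_; lose; find)
open import Data.List.Membership.Propositional.Properties
  using (∈-allFin; ∈-length; ∈-filter⁺; ∈-map⁺; ∈-map⁻; ∈-upTo⁺; ∈-upTo⁻)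
open import Data.List.Relation.Unary.Any as Any using (here; there)
import Data.List.Relation.Unary.All as All
open import Data.List.Relation.Unary.All using (All; []; _∷_)
open import Data.List.Relation.Unary.AllPairs using ([]; _∷_)
open import Data.List.Relation.Unary.Unique.Propositional using (Unique)
import Data.List.Relation.Unary.Unique.Propositional.Properties as Uniqueₚ
open import Function using (_∘_; id)
open import Relation.Nullary using (¬_; Dec; yes; no; ¬?; contradiction; _×-dec_; _⊎-dec_; _→-dec_)
open import Relation.Nullary.Decidable using (map′; decidable-stable)
open import Relation.Binary.Definitions using (DecidableEquality)
open import Relation.Binary.PropositionalEquality
  using (_≡_; _≢_; refl; sym; trans; cong; subst; ≢-sym)
open import Relation.Binary.Construct.Closure.ReflexiveTransitive using (Star; ε; _◅_; _◅◅_; gmap; reverse)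

-- With `t = 5` there are `c + 1` free colours, and a vertex has at most `c` edges that are not
-- frozen. A vertex seeing `c` therefore misses another free colour, but a vertex missing `c` may
-- see all the others. That is the one obstacle to Vizing's argument, in which `c` plays the part of
-- "uncoloured". The treatment of the bad case asks only vertices seeing `c` for a missing colour;
-- when a neighbour met on the way misses `c`, this itself is exploited. Progress is measured by the
-- targets coloured `c` alone: other edges may gain or lose `c` on the way and are cleared of it
-- only when all targets have it. Every interchange runs along a path starting at a vertex that
-- misses one of the two colours, so no cycle is ever switched.

-- Transpositions of colours and the pigeonhole principle

transpose : ℕ → ℕ → ℕ → ℕ
transpose x y κ with κ ℕ.≟ x | κ ℕ.≟ y
... | yes _ | _     = y
... | no _  | yes _ = x
... | no _  | no _  = κ

transpose-left : ∀ x y → transpose x y x ≡ y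
transpose-left x y with x ℕ.≟ x
... | yes _  = refl
... | no x≢x = contradiction refl x≢x

transpose-right : ∀ x y → transpose x y y ≡ x
transpose-right x y with y ℕ.≟ x | y ℕ.≟ y
... | yes y≡x | _      = y≡x
... | no _    | yes _  = refl
... | no _    | no y≢y = contradiction refl y≢y

transpose-other : ∀ {x y κ} → κ ≢ x → κ ≢ y → transpose x y κ ≡ κ
transpose-other {x} {y} {κ} κ≢x κ≢y with κ ℕ.≟ x | κ ℕ.≟ y
... | yes κ≡x | _       = contradiction κ≡x κ≢x
... | no _    | yes κ≡y = contradiction κ≡y κ≢y
... | no _    | no _    = refl

transpose-cases : ∀ x y κ → InAB x y κ → swapAB x y κ (transpose x y κ)
transpose-cases x y _ (inj₁ refl) = inj₁ (refl , transpose-left x y)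
transpose-cases x y _ (inj₂ refl) = inj₂ (refl , transpose-right x y)

transpose-InAB : ∀ {x y κ} → InAB x y κ → InAB x y (transpose x y κ)
transpose-InAB {x} {y} (inj₁ refl) = inj₂ (transpose-left x y)
transpose-InAB {x} {y} (inj₂ refl) = inj₁ (transpose-right x y)

transpose-involutive : ∀ x y κ → transpose x y (transpose x y κ) ≡ κ
transpose-involutive x y κ with κ ℕ.≟ x | κ ℕ.≟ y
... | yes refl | _        = transpose-right x y
... | no _     | yes refl = transpose-left x y
... | no κ≢x   | no κ≢y   = transpose-other κ≢x κ≢y

module Remove {A : Set} (_≟′_ : DecidableEquality A) where

  remove : A → List A → List A
  remove x = filter λ y → ¬? (y ≟′ x)

  length-remove : ∀ {x xs} → x ∈ xs → length (remove x xs) < length xs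
  length-remove {x} {xs} x∈xs = filter-notAll (λ y → ¬? (y ≟′ x)) xs (lose x∈xs λ x≢x → x≢x refl)

  ∈-remove : ∀ {x y xs} → y ∈ xs → y ≢ x → y ∈ remove x xs
  ∈-remove {x} = ∈-filter⁺ λ y → ¬? (y ≟′ x)

-- Pigeonhole: the partner of the head is deleted from `ys`, and injectivity shows that no later
-- element needs it. With a relation in place of a map, the edge that ties two colours together can
-- stay existential.
unique-length-≤ : ∀ {A : Set} {R : A → ℕ → Set} → (∀ {x x' y} → R x y → R x' y → x ≡ x') →
  ∀ {xs} → Unique xs → (ys : List ℕ) → (∀ {x} → x ∈ xs → ∃ λ y → y ∈ ys × R x y) →
  length xs ≤ length ys
unique-length-≤ R-inj [] ys image = z≤n
unique-length-≤ {R = R} R-inj {xs = x ∷ xs} (x∉xs ∷ unique) ys image with image (here refl)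
... | y , y∈ys , Rxy = ℕₚ.≤-trans
        (s≤s (unique-length-≤ R-inj unique (remove y ys) image′)) (length-remove y∈ys)
  where
  open Remove ℕ._≟_
  image′ : ∀ {x'} → x' ∈ xs → ∃ λ y' → y' ∈ remove y ys × R x' y'
  image′ x'∈xs with image (there x'∈xs)
  ... | y' , y'∈ys , Rx'y' = y' , ∈-remove y'∈ys (λ { refl → All.lookup x∉xs x'∈xs (R-inj Rxy Rx'y') }) , Rx'y'

range : ℕ → List ℕ
range k = map suc (upTo k)

∈-range : ∀ {k i} → 1 ≤ i → i ≤ k → i ∈ range k
∈-range {i = suc i} _ i≤k = ∈-map⁺ suc (∈-upTo⁺ i≤k)

range-≤ : ∀ {k i} → i ∈ range k → 1 ≤ i × i ≤ k
range-≤ i∈ with ∈-map⁻ suc i∈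
... | j , j∈ , refl = s≤s z≤n , ∈-upTo⁻ j∈

length-range : ∀ k → length (range k) ≡ k
length-range k = trans (length-map suc (upTo k)) (length-upTo k)

-- Kempe chains

module Incidence (G : Graph) where

  open Remove (_≟_ {m G})

  V E : Set
  V = Fin (n G)
  E = Fin (m G)

  Inc : V → E → Set
  Inc = Incident G

  Joins : E → V → V → Set
  Joins e x y = (src G e ≡ x × tgt G e ≡ y) ⊎ (src G e ≡ y × tgt G e ≡ x)

  private variable
    e e' : E
    p q r w x y z : V

  joins-sym : Joins e x y → Joins e y x
  joins-sym = swap

  inc₁ : Joins e x y → Inc x e
  inc₁ = Sum.map proj₁ proj₂

  inc₂ : Joins e x y → Inc y e
  inc₂ = inc₁ ∘ joins-sym

  far-end : Inc z e → ∃ (Joins e z)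
  far-end (inj₁ s) = _ , inj₁ (s , refl)
  far-end (inj₂ t) = _ , inj₂ (refl , t)

  ends : Joins e x y → Inc z e → z ≡ x ⊎ z ≡ y
  ends (inj₁ (s , t)) = Sum.map (λ i → trans (sym i) s) (λ i → trans (sym i) t)
  ends (inj₂ (s , t)) = swap ∘ Sum.map (λ i → trans (sym i) s) (λ i → trans (sym i) t)

  joins-distinct : Joins e x y → x ≢ y
  joins-distinct {e} (inj₁ (s , t)) x≡y = loopless G e (trans s (trans x≡y (sym t)))
  joins-distinct {e} (inj₂ (s , t)) x≡y = loopless G e (trans s (trans (sym x≡y) (sym t)))

  joins-unique : Joins e x y → Joins e' x y → e ≡ e'
  joins-unique (inj₁ (s , t)) (inj₁ (s' , t')) = simple G _ _ (inj₁ (trans s (sym s') , trans t (sym t')))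
  joins-unique (inj₁ (s , t)) (inj₂ (s' , t')) = simple G _ _ (inj₂ (trans s (sym t') , trans t (sym s')))
  joins-unique (inj₂ (s , t)) (inj₁ (s' , t')) = simple G _ _ (inj₂ (trans s (sym t') , trans t (sym s')))
  joins-unique (inj₂ (s , t)) (inj₂ (s' , t')) = simple G _ _ (inj₁ (trans s (sym s') , trans t (sym t')))

  far-ends-differ : Joins e w x → Joins e' w y → e ≢ e' → x ≢ y
  far-ends-differ je je' e≢e' refl = e≢e' (joins-unique je je')

  Proper : Colouring G → Set
  Proper f = ∀ e e' → Adjacent G e e' → f e ≢ f e'

  colour-unique : ∀ {f} → Proper f → Inc z e → Inc z e' → f e ≡ f e' → e ≡ e'
  colour-unique {z} {e} {e'} proper ie ie' fe≡fe' with e ≟ e'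
  ... | yes e≡e' = e≡e'
  ... | no e≢e'  = contradiction fe≡fe' (proper e e' (e≢e' , z , ie , ie'))

  Misses : Colouring G → V → ℕ → Set
  Misses f z κ = ∀ e → Inc z e → f e ≢ κ

  Sees : Colouring G → V → ℕ → Set
  Sees f z κ = ∃₂ λ e z' → Joins e z z' × f e ≡ κ

  sees-or-misses : ∀ f z κ → Sees f z κ ⊎ Misses f z κ
  sees-or-misses f z κ with any? (λ e → incident? G z e ×-dec (f e ℕ.≟ κ))
  ... | yes (e , ie , fe≡κ) = inj₁ (e , _ , proj₂ (far-end ie) , fe≡κ)
  ... | no none             = inj₂ λ e ie fe≡κ → none (e , ie , fe≡κ)

  -- Alternating f a b p es: from p the edges es are coloured a, b, a, … and cannot be continued.
  data Alternating (f : Colouring G) : ℕ → ℕ → V → List E → Set where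
    stop : ∀ {a b p} → Misses f p a → Alternating f a b p []
    move : ∀ {a b e p q es} → Joins e p q → f e ≡ a → Alternating f b a q es →
           Alternating f a b p (e ∷ es)

  module _ {f : Colouring G} where

    private variable
      a b : ℕ
      es : List E

    On : V → Alternating f a b p es → Set
    On {p = p} z (stop _)     = z ≡ p
    On {p = p} z (move _ _ P) = z ≡ p ⊎ On z P

    on? : ∀ z (P : Alternating f a b p es) → Dec (On z P)
    on? z (stop _)     = z ≟ _
    on? z (move _ _ P) = (z ≟ _) ⊎-dec on? z P

    start-on : (P : Alternating f a b p es) → On p P
    start-on (stop _)     = refl
    start-on (move _ _ _) = inj₁ refl

    edge-on : (P : Alternating f a b p es) → e ∈ es → Inc z e → On z P
    edge-on (move j _ P) (here refl) i with ends j i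
    ... | inj₁ z≡p  = inj₁ z≡p
    ... | inj₂ refl = inj₂ (start-on P)
    edge-on (move _ _ P) (there e∈es) i = inj₂ (edge-on P e∈es i)

    edge-colour : Alternating f a b p es → e ∈ es → InAB a b (f e)
    edge-colour (move _ fe P) (here refl)  = inj₁ fe
    edge-colour (move _ _ P)  (there e∈es) = swap (edge-colour P e∈es)

    last-vertex : Alternating f a b p es → V
    last-vertex {p = p} (stop _)     = p
    last-vertex         (move _ _ P) = last-vertex P

    -- The path takes both coloured edges at each inner vertex and the only one at its last. Just a
    -- `b`-edge at the start can escape; `Used` accounts for it. In the recursion this is the edge
    -- just traversed, in `saturated` there is none.
    saturated-except : {Used : E → Set} → Proper f → (P : Alternating f a b p es) →
      (∀ e → Inc p e → f e ≡ b → Used e) →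
      On z P → Inc z e → InAB a b (f e) → Used e ⊎ e ∈ es
    saturated-except proper (stop miss) used refl i (inj₁ fe≡a) = contradiction fe≡a (miss _ i)
    saturated-except proper (stop miss) used refl i (inj₂ fe≡b) = inj₁ (used _ i fe≡b)
    saturated-except proper (move j fe P) used (inj₁ refl) i (inj₁ fe≡a) =
      inj₂ (here (colour-unique proper i (inc₁ j) (trans fe≡a (sym fe))))
    saturated-except proper (move j fe P) used (inj₁ refl) i (inj₂ fe≡b) = inj₁ (used _ i fe≡b)
    saturated-except proper (move j fe P) used (inj₂ on) i c
      with saturated-except {Used = _≡ _} proper P
             (λ e' i' fe' → colour-unique proper i' (inc₂ j) (trans fe' (sym fe))) on i (swap c)
    ... | inj₁ refl  = inj₂ (here refl)
    ... | inj₂ e∈es = inj₂ (there e∈es)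

    saturated : Proper f → (P : Alternating f a b p es) → Misses f p b →
      On z P → Inc z e → InAB a b (f e) → e ∈ es
    saturated proper P miss on i c with saturated-except proper P miss on i c
    ... | inj₂ e∈es = e∈es

    -- Together with `path-in-component` this identifies the component with a list of edges, in
    -- which membership is decidable.
    component-in-path : ∀ {e₀} → Proper f → (P : Alternating f a b p (e₀ ∷ es)) → Misses f p b →
      SameComponent G f a b e₀ e → e ∈ e₀ ∷ es
    component-in-path proper P miss (here _) = here refl
    component-in-path proper P miss (step same (_ , _ , i , i') c) =
      saturated proper P miss (edge-on P (component-in-path proper P miss same) i) i' c

    -- The colours `a`, `b` change places at each step of the path while the pair `c`, `d` naming
    -- the component stays; `sub` translates.
    extend-component : ∀ {c d e₀} → a ≢ b → (∀ {κ} → InAB a b κ → InAB c d κ) →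
      SameComponent G f c d e₀ e → Inc p e → f e ≡ b → Alternating f a b p es →
      e' ∈ es → SameComponent G f c d e₀ e'
    extend-component {a} {b} {e = e} a≢b sub same i fe≡b (move {e = e₁} j fe₁≡a P) = λ where
        (here refl)   → same₁
        (there e'∈es) → extend-component (≢-sym a≢b) (sub ∘ swap) same₁ (inc₂ j) fe₁≡a P e'∈es
      where
      e≢e₁ : e ≢ e₁
      e≢e₁ e≡e₁ = a≢b (trans (sym fe₁≡a) (trans (cong f (sym e≡e₁)) fe≡b))
      same₁ = step same (e≢e₁ , _ , i , inc₁ j) (sub (inj₁ fe₁≡a))

    path-in-component : ∀ {e₀} → a ≢ b → Alternating f a b p (e₀ ∷ es) →
      e ∈ e₀ ∷ es → SameComponent G f a b e₀ e
    path-in-component a≢b (move j fe P) (here refl)  = here (inj₁ fe)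
    path-in-component a≢b (move j fe P) (there e∈es) =
      extend-component (≢-sym a≢b) swap (here (inj₁ fe)) (inc₂ j) fe P e∈es

    -- As `p` is entered by a `b`-edge, every vertex before the last meets both colours.
    last-is-end : (P : Alternating f a b p es) → Inc p e → f e ≡ b → On z P →
      Misses f z a ⊎ Misses f z b → z ≡ last-vertex P
    last-is-end (stop _) i fe on end = on
    last-is-end (move j fe₁ P) i fe (inj₁ refl) (inj₁ miss) = contradiction fe₁ (miss _ (inc₁ j))
    last-is-end (move j fe₁ P) i fe (inj₁ refl) (inj₂ miss) = contradiction fe (miss _ i)
    last-is-end (move j fe₁ P) i fe (inj₂ on) end = last-is-end P (inc₂ j) fe₁ on (swap end)

    first-or-last : (P : Alternating f a b p es) → On z P →
      Misses f z a ⊎ Misses f z b → z ≡ p ⊎ z ≡ last-vertex P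
    first-or-last (stop _)      on        end = inj₁ on
    first-or-last (move j fe P) (inj₁ on) end = inj₁ on
    first-or-last (move j fe P) (inj₂ on) end = inj₂ (last-is-end P (inc₂ j) fe on (swap end))

    -- The invariants say that the part already walked is a path ending in p, entered by colour b:
    -- an edge met again would have to be incident to a vertex all of whose {a,b}-edges are used.
    walk : Proper f → a ≢ b → (k : ℕ) (unused : List E) → length unused ≤ k →
      (Visited : V → Set) (Used : E → Set) →
      (∀ {z e} → Visited z → Inc z e → InAB a b (f e) → Used e) →
      (∀ {z e} → Used e → Inc z e → Visited z ⊎ z ≡ p) →
      (∀ {e} → Used e → Inc p e → f e ≡ b) →
      (∀ {e} → Inc p e → f e ≡ b → Used e) →
      (∀ e → Used e ⊎ e ∈ unused) → ∃ (Alternating f a b p)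
    walk {a} {b} {p} proper a≢b k unused len Visited Used closed inside entered entering cover
      with sees-or-misses f p a
    ... | inj₂ miss = [] , stop miss
    ... | inj₁ (e , q , j , fe≡a) with k | cover e
    ... | _ | inj₁ used = contradiction (trans (sym fe≡a) (entered used (inc₁ j))) a≢b
    ... | zero | inj₂ e∈unused = contradiction len (ℕₚ.<⇒≱ (∈-length e∈unused))
    ... | suc k | inj₂ e∈unused = _ , move j fe≡a (proj₂ rest)
      where
      fresh : ¬ (Visited q ⊎ q ≡ p)
      fresh (inj₁ vq)  = a≢b (trans (sym fe≡a) (entered (closed vq (inc₂ j) (inj₁ fe≡a)) (inc₁ j)))
      fresh (inj₂ q≡p) = joins-distinct j (sym q≡p)
      rest = walk {b} {a} {q} proper (≢-sym a≢b) k (remove e unused)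
        (ℕₚ.≤-pred (ℕₚ.≤-trans (length-remove e∈unused) len))
        (λ z → Visited z ⊎ z ≡ p) (λ e' → e' ≡ e ⊎ Used e')
        (λ { (inj₁ vz)   i c → inj₂ (closed vz i (swap c))
           ; (inj₂ refl) i (inj₁ fe'≡b) → inj₂ (entering i fe'≡b)
           ; (inj₂ refl) i (inj₂ fe'≡a) →
               inj₁ (colour-unique proper i (inc₁ j) (trans fe'≡a (sym fe≡a))) })
        (λ { (inj₁ refl) i → Sum.map₁ inj₂ (ends j i)
           ; (inj₂ used) i → inj₁ (inside used i) })
        (λ { (inj₁ refl) i → fe≡a
           ; (inj₂ used) i → contradiction (inside used i) fresh })
        (λ i fe'≡a → inj₁ (colour-unique proper i (inc₂ j) (trans fe'≡a (sym fe≡a))))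
        (λ e' → cover′ e' (cover e'))
        where
        cover′ : ∀ e' → Used e' ⊎ e' ∈ unused → (e' ≡ e ⊎ Used e') ⊎ e' ∈ remove e unused
        cover′ e' (inj₁ used) = inj₁ (inj₂ used)
        cover′ e' (inj₂ e'∈unused) with e' ≟ e
        ... | yes e'≡e = inj₁ (inj₁ e'≡e)
        ... | no e'≢e  = inj₂ (∈-remove e'∈unused e'≢e)

    abstract
      chain : Proper f → a ≢ b → Misses f p b → ∃ (Alternating f a b p)
      chain proper a≢b miss = walk proper a≢b _ (allFin (m G)) ℕₚ.≤-refl (λ _ → ⊥) (λ _ → ⊥)
        (λ ()) (λ ()) (λ ()) (λ i fe≡b → miss _ i fe≡b) (λ e → inj₂ (∈-allFin e))

  Link : Colouring G → ℕ → ℕ → V → V → Set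
  Link f a b x y = ∃ λ e → Joins e x y × InAB a b (f e)

  Connected : Colouring G → ℕ → ℕ → V → V → Set
  Connected f a b = Star (Link f a b)

  connected-sym : ∀ {f a b} → Connected f a b x y → Connected f a b y x
  connected-sym = reverse λ (e , j , c) → e , joins-sym j , c

  connected-swap : ∀ {f a b} → Connected f a b x y → Connected f b a x y
  connected-swap = gmap id λ (e , j , c) → e , j , swap c

  on⇒connected : ∀ {f a b es} (P : Alternating f a b p es) → On z P → Connected f a b p z
  on⇒connected (stop _)      refl        = ε
  on⇒connected (move j fe P) (inj₁ refl) = ε
  on⇒connected (move j fe P) (inj₂ on)   = (_ , j , inj₁ fe) ◅ connected-swap (on⇒connected P on)

  module _ {f : Colouring G} {a b : ℕ} {es : List E} (proper : Proper f)
           (P : Alternating f a b p es) (miss : Misses f p b) where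

    connected-on : On x P → Connected f a b x z → On z P
    connected-on on ε = on
    connected-on on ((e , j , c) ◅ rest) =
      connected-on (edge-on P (saturated proper P miss on (inc₁ j) c) (inc₂ j)) rest

    connected⇒on : Connected f a b p z → On z P
    connected⇒on = connected-on (start-on P)

  End : Colouring G → ℕ → ℕ → V → Set
  End f a b p = Misses f p a ⊎ Misses f p b

  abstract
    -- From an end, the maximal alternating path is the whole component, so connectedness is a
    -- search in its vertex list.
    connected? : ∀ {f a b} → Proper f → a ≢ b → End f a b p → ∀ z → Dec (Connected f a b p z)
    connected? proper a≢b (inj₂ miss) z with _ , P ← chain proper a≢b miss =
      map′ (on⇒connected P) (connected⇒on proper P miss) (on? z P)
    connected? proper a≢b (inj₁ miss) z =
      map′ connected-swap connected-swap (connected? proper (≢-sym a≢b) (inj₂ miss) z)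

  -- A Kempe chain is a path or a cycle, so it has at most two ends.
  two-ends : ∀ {f a b} → Proper f → a ≢ b → End f a b p → End f a b q → End f a b r →
    Connected f a b p q → Connected f a b p r → p ≡ q ⊎ p ≡ r ⊎ q ≡ r
  two-ends proper a≢b (inj₂ miss) qe re pq pr with _ , P ← chain proper a≢b miss
    with first-or-last P (connected⇒on proper P miss pq) qe
       | first-or-last P (connected⇒on proper P miss pr) re
  ... | inj₁ q≡p | _        = inj₁ (sym q≡p)
  ... | inj₂ _   | inj₁ r≡p = inj₂ (inj₁ (sym r≡p))
  ... | inj₂ q≡l | inj₂ r≡l = inj₂ (inj₂ (trans q≡l (sym r≡l)))
  two-ends proper a≢b (inj₁ miss) qe re pq pr =
    two-ends proper (≢-sym a≢b) (inj₂ miss) (swap qe) (swap re) (connected-swap pq) (connected-swap pr)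

-- At stage c the colour classes of g above c are already in place and stay frozen; the class c of g
-- is to be matched next.
module Stage (G : Graph) (g : Colouring G) (g-proper : ProperEdgeColouring G 4 g)
             (t c : ℕ) (5≤t : 5 ≤ t) (1≤c : 1 ≤ c) (c≤4 : c ≤ 4) where

  open Incidence G
  open import Data.List.Membership.DecPropositional {A = Fin (m G)} _≟_ using (_∈?_)

  Free : ℕ → Set
  Free κ = (1 ≤ κ × κ ≤ t) × (κ ≤ c ⊎ 4 < κ)

  Other : ℕ → Set
  Other κ = Free κ × κ ≢ c

  Target : E → Set
  Target e = g e ≡ c

  c-free : Free c
  c-free = (1≤c , ℕₚ.≤-trans c≤4 (ℕₚ.≤-trans (ℕₚ.n≤1+n 4) 5≤t)) , inj₁ ℕₚ.≤-refl

  record Valid (f : Colouring G) : Set where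
    field
      proper  : Proper f
      colours : ∀ e → (g e ≤ c × Free (f e)) ⊎ (c < g e × f e ≡ g e)

  open Valid public

  private variable
    f f₁ : Colouring G
    a b κ : ℕ
    e e' h k : E
    es : List E
    p q r u v w x y z : V

  infix 4 _⇝_
  _⇝_ : Colouring G → Colouring G → Set
  _⇝_ = Star (Interchange G t)

  frozen-not-free : c < g e → ¬ Free (g e)
  frozen-not-free c<ge (_ , inj₁ ge≤c) = ℕₚ.<⇒≱ c<ge ge≤c
  frozen-not-free {e} c<ge (_ , inj₂ 4<ge) = ℕₚ.<⇒≱ 4<ge (proj₂ (proj₁ g-proper e))

  free⇒active : Valid f → Free (f e) → g e ≤ c
  free⇒active {e = e} valid free with colours valid e
  ... | inj₁ (ge≤c , _)     = ge≤c
  ... | inj₂ (c<ge , fe≡ge) = contradiction (subst Free fe≡ge free) (frozen-not-free {e = e} c<ge)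

  target-free : Valid f → Target e → Free (f e)
  target-free {e = e} valid target with colours valid e
  ... | inj₁ (_ , free) = free
  ... | inj₂ (c<ge , _) = contradiction (ℕₚ.≤-reflexive target) (ℕₚ.<⇒≱ c<ge)

  target-unique : Inc z e → Inc z e' → Target e → Target e' → e ≡ e'
  target-unique i i' te te' = colour-unique (proj₂ g-proper) i i' (trans te (sym te'))

  InAB-free : Free a → Free b → InAB a b κ → Free κ
  InAB-free fa fb (inj₁ refl) = fa
  InAB-free fa fb (inj₂ refl) = fb

  -- Interchanges along Kempe paths

  record PathFlip (f : Colouring G) (a b : ℕ) (es : List E) : Set where
    field
      result    : Colouring G
      valid     : Valid result
      reach     : f ⇝ result
      flipped   : e ∈ es → result e ≡ transpose a b (f e)
      unflipped : e ∉ es → result e ≡ f e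
      others    : f e ≢ a → f e ≢ b → result e ≡ f e
      others⁻   : result e ≢ a → result e ≢ b → result e ≡ f e
      permutes-missing : e ∈ es → Inc z e → Misses f z κ → Misses result z (transpose a b κ)

    to-right : e ∈ es → f e ≡ a → result e ≡ b
    to-right e∈es fe≡a = trans (flipped e∈es) (trans (cong (transpose a b) fe≡a) (transpose-left a b))

    to-left : e ∈ es → f e ≡ b → result e ≡ a
    to-left e∈es fe≡b = trans (flipped e∈es) (trans (cong (transpose a b) fe≡b) (transpose-right a b))

    from-right : e ∈ es → result e ≡ a → f e ≡ b
    from-right e∈es re≡a = trans (sym (transpose-involutive a b _))
      (trans (cong (transpose a b) (trans (sym (flipped e∈es)) re≡a)) (transpose-left a b))

    from-left : e ∈ es → result e ≡ b → f e ≡ a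
    from-left e∈es re≡b = trans (sym (transpose-involutive a b _))
      (trans (cong (transpose a b) (trans (sym (flipped e∈es)) re≡b)) (transpose-right a b))

    misses-right : e ∈ es → Inc z e → Misses f z a → Misses result z b
    misses-right {z = z} e∈es i = subst (Misses result z) (transpose-left a b) ∘ permutes-missing e∈es i

    misses-left : e ∈ es → Inc z e → Misses f z b → Misses result z a
    misses-left {z = z} e∈es i = subst (Misses result z) (transpose-right a b) ∘ permutes-missing e∈es i

    keeps-misses : κ ≢ a → κ ≢ b → Misses f z κ → Misses result z κ
    keeps-misses κ≢a κ≢b miss e i re≡κ =
      miss e i (trans (sym (others⁻ (κ≢a ∘ trans (sym re≡κ)) (κ≢b ∘ trans (sym re≡κ)))) re≡κ)

  build-path-flip : Valid f → Free a → Free b → a ≢ b → Alternating f a b p es → Misses f p b →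
    PathFlip f a b es
  -- Here `p` misses both colours and nothing is interchanged: an `Interchange` needs an edge to
  -- start from.
  build-path-flip {f = f} f-valid a-free b-free a≢b (stop _) miss = record
    { result = f ; valid = f-valid ; reach = ε ; flipped = λ () ; unflipped = λ _ → refl
    ; others = λ _ _ → refl ; others⁻ = λ _ _ → refl ; permutes-missing = λ () }
  build-path-flip {f = f} {a} {b} f-valid a-free b-free a≢b P@(move {e = e₀} {es = es′} j fe₀ _) miss = record
    { result = f′ ; valid = record { proper = proper′ ; colours = colours′ }
    ; reach = interchange ◅ ε ; flipped = λ {e} → in-path {e} ; unflipped = λ {e} → off-path {e}
    ; others = λ {e} → others {e} ; others⁻ = λ {e} → others⁻ {e}
    ; permutes-missing = λ {e} {z} {κ} → permutes {e} {z} {κ} }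
    where
    path = e₀ ∷ es′

    f′ : Colouring G
    f′ e with e ∈? path
    ... | yes _ = transpose a b (f e)
    ... | no _  = f e

    in-path : e ∈ path → f′ e ≡ transpose a b (f e)
    in-path {e} e∈es with e ∈? path
    ... | yes _    = refl
    ... | no e∉es = contradiction e∈es e∉es

    off-path : e ∉ path → f′ e ≡ f e
    off-path {e} e∉es with e ∈? path
    ... | yes e∈es = contradiction e∈es e∉es
    ... | no _     = refl

    absorbs : e ∈ path → Inc z e → Inc z e' → InAB a b (f e') → e' ∈ path
    absorbs e∈es i i' = saturated (proper f-valid) P miss (edge-on P e∈es i) i'

    others : f e ≢ a → f e ≢ b → f′ e ≡ f e
    others fe≢a fe≢b = off-path λ e∈es → [ fe≢a , fe≢b ]′ (edge-colour P e∈es)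

    others⁻ : f′ e ≢ a → f′ e ≢ b → f′ e ≡ f e
    others⁻ {e} f′e≢a f′e≢b with e ∈? path
    ... | no _     = refl
    ... | yes e∈es = ⊥-elim ([ f′e≢a , f′e≢b ]′ (transpose-InAB (edge-colour P e∈es)))

    permutes : e ∈ path → Inc z e → Misses f z κ → Misses f′ z (transpose a b κ)
    permutes {κ = κ} e∈es i miss-κ e' i' f′e'≡ with e' ∈? path
    ... | yes _ = miss-κ e' i' (trans (sym (transpose-involutive a b _))
            (trans (cong (transpose a b) f′e'≡) (transpose-involutive a b κ)))
    ... | no e'∉es = miss-κ e' i' (trans (sym (transpose-other (e'∉es ∘ absorbs e∈es i i' ∘ inj₁)
            (e'∉es ∘ absorbs e∈es i i' ∘ inj₂)))
            (trans (cong (transpose a b) f′e'≡) (transpose-involutive a b κ)))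

    proper′ : Proper f′
    proper′ e e' adj@(e≢e' , z , i , i') f′e≡f′e' with e ∈? path | e' ∈? path
    ... | yes _    | yes _     = proper f-valid e e' adj
            (trans (sym (transpose-involutive a b _))
              (trans (cong (transpose a b) f′e≡f′e') (transpose-involutive a b _)))
    -- A flipped edge still has colour `a` or `b`; a neighbour of the same colour would have been
    -- absorbed by the path.
    ... | yes e∈es | no e'∉es =
            e'∉es (absorbs e∈es i i'
              (subst (InAB a b) f′e≡f′e' (transpose-InAB (edge-colour P e∈es))))
    ... | no e∉es | yes e'∈es =
            e∉es (absorbs e'∈es i' i
              (subst (InAB a b) (sym f′e≡f′e') (transpose-InAB (edge-colour P e'∈es))))
    ... | no _     | no _      = proper f-valid e e' adj f′e≡f′e'

    colours′ : ∀ e → (g e ≤ c × Free (f′ e)) ⊎ (c < g e × f′ e ≡ g e)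
    colours′ e with e ∈? path
    ... | no _     = colours f-valid e
    ... | yes e∈es = inj₁
      ( free⇒active f-valid (InAB-free a-free b-free (edge-colour P e∈es))
      , InAB-free a-free b-free (transpose-InAB (edge-colour P e∈es)))

    interchange : Interchange G t f f′
    interchange = a , b , e₀ , proj₁ (proj₁ a-free) , proj₂ (proj₁ a-free)
      , proj₁ (proj₁ b-free) , proj₂ (proj₁ b-free) , a≢b , inj₁ fe₀ , λ e →
        (λ same → subst (swapAB a b (f e)) (sym (in-path (component-in-path (proper f-valid) P miss same)))
                    (transpose-cases a b (f e) (edge-colour P (component-in-path (proper f-valid) P miss same))))
      , (λ other → off-path (other ∘ path-in-component a≢b P))

  abstract
    path-flip : Valid f → Free a → Free b → a ≢ b → Alternating f a b p es → Misses f p b →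
      PathFlip f a b es
    path-flip = build-path-flip

  -- The edges coloured `c` are exactly the same before and after, so bad ends and vertices missing
  -- `c` survive.
  record Keeps (f f₁ : Colouring G) : Set where
    field
      valid    : Valid f₁
      reach    : f ⇝ f₁
      keeps    : f e ≡ c → f₁ e ≡ c
      reflects : f₁ e ≡ c → f e ≡ c

  keeps-misses-c : Keeps f f₁ → Misses f z c → Misses f₁ z c
  keeps-misses-c K miss e i f₁e≡c = miss e i (Keeps.reflects K f₁e≡c)

  record Switched (f : Colouring G) (a b : ℕ) (r : V) : Set where
    field
      result    : Colouring G
      keeping   : Keeps f result
      now-miss  : Misses result r a
      elsewhere : ¬ Connected f a b r z → Inc z e → result e ≡ f e
      others    : f e ≢ a → f e ≢ b → result e ≡ f e
      others⁻   : result e ≢ a → result e ≢ b → result e ≡ f e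

    keeps-misses : κ ≢ a → κ ≢ b → Misses f z κ → Misses result z κ
    keeps-misses κ≢a κ≢b miss e i re≡κ =
      miss e i (trans (sym (others⁻ (κ≢a ∘ trans (sym re≡κ)) (κ≢b ∘ trans (sym re≡κ)))) re≡κ)

    elsewhere-misses : ¬ Connected f a b r z → Misses f z κ → Misses result z κ
    elsewhere-misses away miss e i re≡κ = miss e i (trans (sym (elsewhere away i)) re≡κ)

  switch : Valid f → Other a → Other b → a ≢ b → Misses f r b → Switched f a b r
  switch {f} {a} {b} {r} f-valid (a-free , a≢c) (b-free , b≢c) a≢b miss
    with es , P ← chain (proper f-valid) a≢b miss = record
    { result = result ; now-miss = now-miss ; elsewhere = elsewhere
    ; others = λ {e} → others {e} ; others⁻ = λ {e} → others⁻ {e}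
    ; keeping = record
        { valid = valid ; reach = reach
        ; keeps = λ fe≡c → trans (others (a≢c ∘ sym ∘ trans (sym fe≡c)) (b≢c ∘ sym ∘ trans (sym fe≡c))) fe≡c
        ; reflects = λ re≡c →
            trans (sym (others⁻ (a≢c ∘ sym ∘ trans (sym re≡c)) (b≢c ∘ sym ∘ trans (sym re≡c)))) re≡c } }
    where
    open PathFlip (path-flip f-valid a-free b-free a≢b P miss)

    elsewhere : ¬ Connected f a b r z → Inc z e → result e ≡ f e
    elsewhere away i = unflipped λ e∈es → away (on⇒connected P (edge-on P e∈es i))

    now-miss : Misses result r a
    now-miss e i re≡a with e ∈? es
    ... | no e∉es  = e∉es (saturated (proper f-valid) P miss (start-on P) i
                       (inj₁ (trans (sym (unflipped e∉es)) re≡a)))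
    ... | yes e∈es = miss e i (from-right e∈es re≡a)

  record Recolouring (f : Colouring G) (e : E) (κ : ℕ) : Set where
    field
      result     : Colouring G
      valid      : Valid result
      reach      : f ⇝ result
      recoloured : result e ≡ κ
      unchanged  : e' ≢ e → result e' ≡ f e'
      freed      : Inc z e → Misses result z (f e)

    still-misses : ∀ {μ} → κ ≢ μ → Misses f z μ → Misses result z μ
    still-misses κ≢μ miss e' i re'≡μ with e' ≟ e
    ... | yes refl = κ≢μ (trans (sym recoloured) re'≡μ)
    ... | no e'≢e  = miss e' i (trans (sym (unchanged e'≢e)) re'≡μ)

    keeping : f e ≢ c → κ ≢ c → Keeps f result
    keeping fe≢c κ≢c = record
      { valid = valid ; reach = reach ; keeps = keeps ; reflects = reflects }
      where
      keeps : f e' ≡ c → result e' ≡ c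
      keeps {e'} fe'≡c with e' ≟ e
      ... | yes refl = contradiction fe'≡c fe≢c
      ... | no e'≢e  = trans (unchanged e'≢e) fe'≡c
      reflects : result e' ≡ c → f e' ≡ c
      reflects {e'} re'≡c with e' ≟ e
      ... | yes refl = contradiction (trans (sym recoloured) re'≡c) κ≢c
      ... | no e'≢e  = trans (sym (unchanged e'≢e)) re'≡c

  -- As both ends miss `κ`, the edge is a Kempe chain by itself.
  recolour : Valid f → Joins e x y → Free (f e) → Free κ → f e ≢ κ → Misses f x κ → Misses f y κ →
    Recolouring f e κ
  recolour {f = f} {e = e} f-valid j fe-free κ-free fe≢κ x-miss y-miss = record
    { result = result ; valid = valid ; reach = reach ; recoloured = to-right (here refl) refl
    ; unchanged = λ {e'} → unchanged {e'} ; freed = freed }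
    where
    open PathFlip (path-flip f-valid fe-free κ-free fe≢κ (move j refl (stop y-miss)) x-miss)
    unchanged : e' ≢ e → result e' ≡ f e'
    unchanged e'≢e = unflipped λ { (here e'≡e) → e'≢e e'≡e }
    freed : Inc z e → Misses result z (f e)
    freed i with ends j i
    ... | inj₁ refl = misses-left (here refl) i x-miss
    ... | inj₂ refl = misses-left (here refl) i y-miss

  -- One more target is coloured `c`. Edges that are no targets may lose `c` at no cost.
  record Gain (f : Colouring G) (e : E) : Set where
    field
      result  : Colouring G
      valid   : Valid result
      reach   : f ⇝ result
      keeps   : Target e' → f e' ≡ c → result e' ≡ c
      gained  : result e ≡ c

  gain-after : f ⇝ f₁ → (∀ {e'} → Target e' → f e' ≡ c → f₁ e' ≡ c) → Gain f₁ e → Gain f e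
  gain-after reach keeps γ = record
    { result = Gain.result γ ; valid = Gain.valid γ ; reach = reach ◅◅ Gain.reach γ
    ; keeps = λ te' → Gain.keeps γ te' ∘ keeps te' ; gained = Gain.gained γ }

  gain-keeping : Keeps f f₁ → Gain f₁ e → Gain f e
  gain-keeping K = gain-after (Keeps.reach K) (λ _ → Keeps.keeps K)

  -- The target `l` is given up to install `e` and is then regained by `γ`, which cannot lose `e`
  -- again.
  gain-exchange : ∀ {l} → f ⇝ f₁ → (∀ {e'} → Target e' → e' ≢ l → f e' ≡ c → f₁ e' ≡ c) →
    Target e → f₁ e ≡ c → Gain f₁ l → Gain f e
  gain-exchange {f = f} {l = l} reach keeps te f₁e≡c γ = record
    { result = Gain.result γ ; valid = Gain.valid γ ; reach = reach ◅◅ Gain.reach γ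
    ; keeps = keeps′ ; gained = Gain.keeps γ te f₁e≡c }
    where
    keeps′ : Target e' → f e' ≡ c → Gain.result γ e' ≡ c
    keeps′ {e'} te' fe'≡c with e' ≟ l
    ... | yes refl = Gain.gained γ
    ... | no e'≢l  = Gain.keeps γ te' (keeps te' e'≢l fe'≡c)

  gain-between-missing : Valid f → Target e → Joins e u v → Misses f u c → Misses f v c → Gain f e
  gain-between-missing {f = f} {e = e} f-valid te j u-miss v-miss = record
    { result = result ; valid = valid ; reach = reach ; keeps = λ _ → keeps ; gained = recoloured }
    where
    open Recolouring (recolour f-valid j (target-free f-valid te) c-free (u-miss e (inc₁ j)) u-miss v-miss)
    keeps : f e' ≡ c → result e' ≡ c
    keeps {e'} fe'≡c with e' ≟ e
    ... | yes refl = recoloured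
    ... | no e'≢e  = trans (unchanged e'≢e) fe'≡c

  -- A bad target edge at a vertex missing c

  -- The colour `a` of the overview is `f e`. Since `e` is the target at `v`, the edge `h` is none
  -- and may lose `c`.
  record BadEnd (f : Colouring G) (e h : E) (u v w : V) : Set where
    field
      valid    : Valid f
      target   : Target e
      uv       : Joins e u v
      vw       : Joins h v w
      h-colour : f h ≡ c
      u-misses : Misses f u c

    e≢c : f e ≢ c
    e≢c = u-misses e (inc₁ uv)

    e-other : Other (f e)
    e-other = target-free valid target , e≢c

    e≢h : e ≢ h
    e≢h refl = e≢c h-colour

    h-not-target : ¬ Target h
    h-not-target th = e≢h (target-unique (inc₂ uv) (inc₁ vw) target th)

    u≢w : u ≢ w
    u≢w refl = u-misses h (inc₂ vw) h-colour

    c-edge-at-v : Inc v k → f k ≡ c → k ≡ h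
    c-edge-at-v i fk≡c = colour-unique (proper valid) i (inc₁ vw) (trans fk≡c (sym h-colour))

    c-edge-at-w : Inc w k → f k ≡ c → k ≡ h
    c-edge-at-w i fk≡c = colour-unique (proper valid) i (inc₂ vw) (trans fk≡c (sym h-colour))

    e-not-at-w : ¬ Inc w e
    e-not-at-w i with ends uv i
    ... | inj₁ w≡u = u≢w (sym w≡u)
    ... | inj₂ w≡v = joins-distinct vw (sym w≡v)

    neighbour-of-w : Joins k w x → f k ≢ c → x ≢ v × x ≢ w
    neighbour-of-w kJ fk≢c =
      far-ends-differ kJ (joins-sym vw) (λ { refl → fk≢c h-colour }) , ≢-sym (joins-distinct kJ)

    c-edge-avoids : Joins k x y → f k ≡ c → x ≢ v → x ≢ w → k ≢ h × y ≢ v × y ≢ w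
    c-edge-avoids {k} {x} kJ fk≡c x≢v x≢w =
      k≢h , (λ { refl → k≢h (c-edge-at-v (inc₂ kJ) fk≡c) }) , (λ { refl → k≢h (c-edge-at-w (inc₂ kJ) fk≡c) })
      where
      k≢h : k ≢ h
      k≢h refl = [ x≢v , x≢w ]′ (ends vw (inc₁ kJ))

    after-recolouring : (R : Recolouring f k κ) → κ ≢ c → k ≢ h → BadEnd (Recolouring.result R) e h u v w
    after-recolouring R κ≢c k≢h = record
      { valid = Recolouring.valid R ; target = target ; uv = uv ; vw = vw
      ; h-colour = trans (Recolouring.unchanged R (≢-sym k≢h)) h-colour
      ; u-misses = Recolouring.still-misses R κ≢c u-misses }

    flip-gain : Alternating f (f e) c u es → e ∈ es →
      (∀ {e'} → e' ∈ es → f e' ≡ c → ¬ Target e') → Gain f e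
    flip-gain {es} P e∈es off = record
      { result = result ; valid = valid′ ; reach = reach ; keeps = keeps ; gained = to-right e∈es refl }
      where
      open PathFlip (path-flip valid (proj₁ e-other) c-free e≢c P u-misses)
        renaming (valid to valid′)
      keeps : Target e' → f e' ≡ c → result e' ≡ c
      keeps {e'} te' fe'≡c with e' ∈? es
      ... | yes e'∈es = contradiction te' (off e'∈es fe'≡c)
      ... | no e'∉es  = trans (unflipped e'∉es) fe'≡c

    -- Giving `h` the colour `κ` makes `v` miss `c`, as `u` does already.
    gain-recolouring-h : Other κ → Misses f v κ → Misses f w κ → Gain f e
    gain-recolouring-h {κ} (κ-free , κ≢c) v-miss w-miss = gain-after reach
      (λ te' fe'≡c → trans (unchanged λ { refl → h-not-target te' }) fe'≡c)
      (gain-between-missing valid′ target uv (still-misses κ≢c u-misses)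
        (subst (Misses result v) h-colour (freed (inc₁ vw))))
      where
      open Recolouring (recolour valid vw (subst Free (sym h-colour) c-free) κ-free
        (λ fh≡κ → κ≢c (trans (sym fh≡κ) h-colour)) v-miss w-miss) renaming (valid to valid′)

    -- The chain of `f e` and `c` from `u` consists of `e` and `h`; flipping it trades the colour
    -- `c` of `h` for that of `e`.
    gain-at-w : Misses f w (f e) → Gain f e
    gain-at-w w-miss = flip-gain (move uv refl (move vw h-colour (stop w-miss))) (here refl) λ where
      (here refl)         e≡c → contradiction e≡c e≢c
      (there (here refl)) _   → h-not-target

    gain-past-w : Joins k w z → f k ≡ f e → Misses f z c → Gain f e
    gain-past-w kJ fk≡fe z-miss =
      flip-gain (move uv refl (move vw h-colour (move kJ fk≡fe (stop z-miss)))) (here refl) λ where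
        (here refl)                 e≡c → contradiction e≡c e≢c
        (there (here refl))         _   → h-not-target
        (there (there (here refl))) k≡c → contradiction (trans (sym fk≡fe) k≡c) e≢c

    -- The chain of `κ` and `c` from `z` is `k`, `h`. Flipping it slides `c` from `h` to `k`, so
    -- that `v` misses `c`; with `z` equal to `u` it would bring `c` to `u`.
    gain-sliding-h : Joins k w z → f k ≡ κ → Other κ → Misses f v κ → Misses f z c → z ≢ u → Gain f e
    gain-sliding-h {k} {z} kJ refl (fk-free , fk≢c) v-miss z-miss z≢u = gain-after reach keeps
      (gain-between-missing valid′ target uv u-misses′ (misses-right (there (here refl)) (inc₁ vw) v-miss))
      where
      open PathFlip (path-flip valid fk-free c-free fk≢c (move (joins-sym kJ) refl
        (move (joins-sym vw) h-colour (stop v-miss))) z-miss)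
        renaming (valid to valid′)
      keeps : Target e' → f e' ≡ c → result e' ≡ c
      keeps te' fe'≡c = trans (unflipped λ where
        (here refl)         → fk≢c fe'≡c
        (there (here refl)) → h-not-target te') fe'≡c
      u-misses′ : Misses result u c
      u-misses′ e' i re'≡c with e' ∈? (k ∷ h ∷ [])
      ... | no e'∉ = u-misses e' i (trans (sym (unflipped e'∉)) re'≡c)
      ... | yes (there (here refl)) with ends vw i
      ... | inj₁ u≡v = joins-distinct uv u≡v
      ... | inj₂ u≡w = u≢w u≡w
      u-misses′ e' i re'≡c | yes (here refl) with ends kJ i
      ... | inj₁ u≡w = u≢w u≡w
      ... | inj₂ u≡z = z≢u (sym u≡z)

  keep-bad-end : ∀ {h} → BadEnd f e h u v w → Keeps f f₁ → BadEnd f₁ e h u v w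
  keep-bad-end B K = record
    { valid = Keeps.valid K ; target = target ; uv = uv ; vw = vw
    ; h-colour = Keeps.keeps K h-colour ; u-misses = keeps-misses-c K u-misses }
    where open BadEnd B

  -- Frames: colours missed at both ends of the `c`-edge

  private variable
    α β δ : ℕ

  separated : Valid f → a ≢ b → End f a b p → End f a b q → End f a b r → p ≢ q → p ≢ r → q ≢ r →
    Connected f a b p q → ¬ Connected f a b r p × ¬ Connected f a b r q
  separated f-valid a≢b pe qe re p≢q p≢r q≢r pq =
    distinct ∘ connected-sym , λ rq → distinct (pq ◅◅ connected-sym rq)
    where
    distinct = λ pr → [ p≢q , [ p≢r , q≢r ]′ ]′ (two-ends (proper f-valid) a≢b pe qe re pq pr)

  record Frame (f : Colouring G) (e h : E) (u v w : V) (α β : ℕ) : Set where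
    field
      bad-end  : BadEnd f e h u v w
      α-other  : Other α
      β-other  : Other β
      α≢β      : α ≢ β
      v-misses : Misses f v α
      w-misses : Misses f w β

    open BadEnd bad-end public

    keep-frame : Keeps f f₁ → Misses f₁ v α → Misses f₁ w β → Frame f₁ e h u v w α β
    keep-frame K v-misses′ w-misses′ = record
      { bad-end = keep-bad-end bad-end K ; α-other = α-other ; β-other = β-other ; α≢β = α≢β
      ; v-misses = v-misses′ ; w-misses = w-misses′ }

    fe≢α : f e ≢ α
    fe≢α = v-misses e (inc₂ uv)

    -- If `w` and `v` lie on different chains, a switch at `w` makes both miss `α`, and `h` can be
    -- recoloured.
    linked : (Connected f β α w v → Gain f e) → Gain f e
    linked use with connected? (proper valid) (≢-sym α≢β) (inj₁ w-misses) v
    ... | yes w~v = use w~v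
    ... | no away = gain-keeping (Switched.keeping S) (BadEnd.gain-recolouring-h
            (keep-bad-end bad-end (Switched.keeping S)) α-other
            (Switched.elsewhere-misses S (away ∘ connected-swap) v-misses) (Switched.now-miss S))
      where S = switch valid α-other β-other α≢β w-misses

    -- The chain of `w` and `v` has these two as its ends, so the chain of a third vertex `r`
    -- missing `α` can be switched without touching either.
    shift-α-to-β : Misses f r α → r ≢ v → r ≢ w →
      ((S : Switched f β α r) → Frame (Switched.result S) e h u v w α β →
        ¬ Connected f β α r w → ¬ Connected f β α r v → Gain (Switched.result S) e) →
      Gain f e
    shift-α-to-β r-miss r≢v r≢w use = linked λ w~v →
      let away-w , away-v = separated valid (≢-sym α≢β) (inj₁ w-misses) (inj₂ v-misses) (inj₂ r-miss)
                              (≢-sym (joins-distinct vw)) (≢-sym r≢w) (≢-sym r≢v) w~v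
          S = switch valid β-other α-other (≢-sym α≢β) r-miss
      in gain-keeping (Switched.keeping S) (use S
           (keep-frame (Switched.keeping S) (Switched.elsewhere-misses S away-v v-misses)
             (Switched.elsewhere-misses S away-w w-misses))
           away-w away-v)

  -- Recolouring `k` with `β` makes `w` miss `f e`, so the chain from `u` stops at `w`.
  gain-if-β : Frame f e h u v w α β → Joins k w z → f k ≡ f e → Misses f z β → Gain f e
  gain-if-β {f = f} {e = e} {w = w} {k = k} F kJ fk≡fe z-miss =
    gain-keeping K (BadEnd.gain-at-w (keep-bad-end bad-end K)
      (subst (Misses result w) (trans fk≡fe (sym (unchanged e≢k))) (freed (inc₁ kJ))))
    where
    open Frame F hiding (valid)
    e≢k : e ≢ k
    e≢k refl = e-not-at-w (inc₁ kJ)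
    open Recolouring (recolour (Frame.valid F) kJ (subst Free (sym fk≡fe) (proj₁ e-other)) (proj₁ β-other)
      (w-misses k (inc₁ kJ)) w-misses z-miss)
    K = keeping (λ fk≡c → e≢c (trans (sym fk≡fe) fk≡c)) (proj₂ β-other)

  gain-if-α : Frame f e h u v w α β → Joins k w z → f k ≡ f e → Misses f z α → Gain f e
  gain-if-α F kJ fk≡fe z-miss =
    let z≢v , z≢w = neighbour-of-w kJ (λ fk≡c → e≢c (trans (sym fk≡fe) fk≡c))
    in shift-α-to-β z-miss z≢v z≢w λ S F′ away-w away-v →
      gain-if-β F′ kJ
        (trans (Switched.elsewhere S away-w (inc₁ kJ))
          (trans fk≡fe (sym (Switched.elsewhere S away-v (inc₂ uv)))))
        (Switched.now-miss S)
    where open Frame F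

  -- Recolouring `k` with `β` makes `w` miss `α`, which `v` misses too, so `h` can take `α`.
  gain-recolouring-α : Frame f e h u v w α β → Joins k w z → f k ≡ α → Misses f z β → Gain f e
  gain-recolouring-α {f = f} {w = w} {k = k} F kJ fk≡α z-miss =
    gain-keeping K (BadEnd.gain-recolouring-h
      (keep-bad-end bad-end K) α-other (still-misses (≢-sym α≢β) v-misses)
      (subst (Misses result w) fk≡α (freed (inc₁ kJ))))
    where
    open Frame F hiding (valid)
    open Recolouring (recolour (Frame.valid F) kJ (subst Free (sym fk≡α) (proj₁ α-other)) (proj₁ β-other)
      (w-misses k (inc₁ kJ)) w-misses z-miss)
    K = keeping (λ fk≡c → proj₂ α-other (trans (sym fk≡α) fk≡c)) (proj₂ β-other)

  -- Sliding `h` along the `α`-edge `k` needs `s` to miss `c`. What prevents this is `l`, which may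
  -- be recoloured since it is no target.
  record Spoke (f : Colouring G) (u w : V) (α : ℕ) (k l : E) (s s' : V) : Set where
    field
      kJ       : Joins k w s
      k-colour : f k ≡ α
      s≢u      : s ≢ u
      lJ       : Joins l s s'
      l-colour : f l ≡ c
      l-off    : ¬ Target l

  keep-spoke : ∀ {l s s'} → Spoke f u w α k l s s' → Keeps f f₁ → f₁ k ≡ f k → Spoke f₁ u w α k l s s'
  keep-spoke P K f₁k≡fk = record
    { kJ = kJ ; k-colour = trans f₁k≡fk k-colour ; s≢u = s≢u ; lJ = lJ
    ; l-colour = Keeps.keeps K l-colour ; l-off = l-off }
    where open Spoke P

  gain-freeing-s : ∀ {l s s'} → BadEnd f e h u v w → Other α → Misses f v α → Spoke f u w α k l s s' →
    Other κ → Misses f s κ → Misses f s' κ → Gain f e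
  gain-freeing-s {f = f} {α = α} {k = k} {κ = κ} {s = s} B α-other v-miss P (κ-free , κ≢c) s-miss s'-miss =
    gain-after reach (λ te' fe'≡c → trans (unchanged λ { refl → l-off te' }) fe'≡c)
      (BadEnd.gain-sliding-h (after-recolouring R κ≢c (proj₁ l-avoids)) kJ
        (trans (unchanged λ { refl → k≢c l-colour }) k-colour) α-other
        (still-misses κ≢α v-miss) (subst (Misses result s) l-colour (freed (inc₁ lJ))) s≢u)
    where
    open BadEnd B hiding (valid)
    open Spoke P
    k≢c : f k ≢ c
    k≢c k≡c = proj₂ α-other (trans (sym k-colour) k≡c)
    s-apart = neighbour-of-w kJ k≢c
    l-avoids = c-edge-avoids lJ l-colour (proj₁ s-apart) (proj₂ s-apart)
    κ≢α : κ ≢ α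
    κ≢α refl = s-miss k (inc₂ kJ) k-colour
    R = recolour (BadEnd.valid B) lJ (subst Free (sym l-colour) c-free) κ-free
          (λ fl≡κ → κ≢c (trans (sym fl≡κ) l-colour)) s-miss s'-miss
    open Recolouring R

  -- All of `w`, `s`, `s'` are ends of chains of `κ` and `β`, so not all three share one. If `w` and
  -- `s` are apart, a switch at `s` makes it miss `β` and `k` can be recoloured. Otherwise `s'` is
  -- apart from both, and a switch there makes it miss `κ` like `s`, so `l` can be recoloured.
  gain-at-α-edge : ∀ {l s s'} → Frame f e h u v w α β → Spoke f u w α k l s s' →
    Other κ → κ ≢ β → Misses f s κ → Misses f s' β → Gain f e
  gain-at-α-edge {f = f} {w = w} {α = α} {β = β} {k = k} {κ = κ} {s = s} {s' = s'} F P κ-other κ≢β s-miss s'-miss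
    = by-linkage (connected? valid κ≢β (inj₂ w-misses) s)
    where
    open Frame F hiding (valid)
    open Spoke P
    valid = proper (Frame.valid F)
    α≢κ : α ≢ κ
    α≢κ refl = s-miss k (inc₂ kJ) k-colour
    s-apart = neighbour-of-w kJ λ k≡c → proj₂ α-other (trans (sym k-colour) k≡c)
    s'-apart = proj₂ (c-edge-avoids lJ l-colour (proj₁ s-apart) (proj₂ s-apart))
    S = switch (Frame.valid F) β-other κ-other (≢-sym κ≢β) s-miss
    S' = switch (Frame.valid F) κ-other β-other κ≢β s'-miss
    by-linkage : Dec (Connected f κ β w s) → Gain f _
    by-linkage (no away) = gain-keeping (Switched.keeping S)
      (gain-recolouring-α
        (keep-frame (Switched.keeping S)
          (Switched.keeps-misses S α≢β α≢κ v-misses)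
          (Switched.elsewhere-misses S (away ∘ connected-sym ∘ connected-swap) w-misses))
        kJ
        (trans (Switched.others S (α≢β ∘ trans (sym k-colour)) (α≢κ ∘ trans (sym k-colour))) k-colour)
        (Switched.now-miss S))
    by-linkage (yes w~s) = gain-keeping (Switched.keeping S')
      (gain-freeing-s (keep-bad-end bad-end (Switched.keeping S')) α-other
        (Switched.keeps-misses S' α≢κ α≢β v-misses)
        (keep-spoke P (Switched.keeping S')
          (Switched.others S' (α≢κ ∘ trans (sym k-colour)) (α≢β ∘ trans (sym k-colour))))
        κ-other (Switched.elsewhere-misses S' s-away s-miss) (Switched.now-miss S'))
      where
      s-away : ¬ Connected f κ β s' s
      s-away = proj₂ (separated (Frame.valid F) κ≢β (inj₂ w-misses) (inj₁ s-miss) (inj₂ s'-miss)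
        (≢-sym (proj₂ s-apart)) (≢-sym (proj₂ s'-apart)) (joins-distinct lJ) w~s)

  -- Spurs: the neighbour of `w` along the colour of the bad target edge

  record Spur (f : Colouring G) (e h : E) (u v w : V) (α β : ℕ) (k : E) (p : V) (δ : ℕ) : Set where
    field
      frame    : Frame f e h u v w α β
      kJ       : Joins k w p
      k-colour : f k ≡ f e
      δ-other  : Other δ
      δ≢α      : δ ≢ α
      δ≢β      : δ ≢ β
      p-misses : Misses f p δ

    open Frame frame public

    fe≢β : f e ≢ β
    fe≢β fe≡β = w-misses k (inc₁ kJ) (trans k-colour fe≡β)

    fe≢δ : f e ≢ δ
    fe≢δ fe≡δ = p-misses k (inc₂ kJ) (trans k-colour fe≡δ)

    k≢c : f k ≢ c
    k≢c k≡c = e≢c (trans (sym k-colour) k≡c)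

    p≢v : p ≢ v
    p≢v = proj₁ (neighbour-of-w kJ k≢c)

    p≢w : p ≢ w
    p≢w = proj₂ (neighbour-of-w kJ k≢c)

    keep-spur : Keeps f f₁ → Misses f₁ v α → Misses f₁ w β → Misses f₁ p δ → f₁ k ≡ f k → f₁ e ≡ f e →
      Spur f₁ e h u v w α β k p δ
    keep-spur K v-miss w-miss p-miss f₁k≡fk f₁e≡fe = record
      { frame = keep-frame K v-miss w-miss ; kJ = kJ ; k-colour = trans f₁k≡fk (trans k-colour (sym f₁e≡fe))
      ; δ-other = δ-other ; δ≢α = δ≢α ; δ≢β = δ≢β ; p-misses = p-miss }

    switched-βδ : (S : Switched f β δ r) → ¬ Connected f β δ r w → ¬ Connected f β δ r p →
      Spur (Switched.result S) e h u v w α β k p δ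
    switched-βδ S away-w away-p = keep-spur (Switched.keeping S)
      (Switched.keeps-misses S α≢β (≢-sym δ≢α) v-misses)
      (Switched.elsewhere-misses S away-w w-misses) (Switched.elsewhere-misses S away-p p-misses)
      (Switched.elsewhere S away-w (inc₁ kJ)) (Switched.others S fe≢β fe≢δ)

    switched-δβ : (S : Switched f δ β r) → ¬ Connected f δ β r w → ¬ Connected f δ β r p →
      Spur (Switched.result S) e h u v w α β k p δ
    switched-δβ S away-w away-p = keep-spur (Switched.keeping S)
      (Switched.keeps-misses S (≢-sym δ≢α) α≢β v-misses)
      (Switched.elsewhere-misses S away-w w-misses) (Switched.elsewhere-misses S away-p p-misses)
      (Switched.elsewhere S away-w (inc₁ kJ)) (Switched.others S fe≢δ fe≢β)

    switched-βα : (S : Switched f β α r) → ¬ Connected f β α r w → ¬ Connected f β α r v →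
      Spur (Switched.result S) e h u v w α β k p δ
    switched-βα S away-w away-v = keep-spur (Switched.keeping S)
      (Switched.elsewhere-misses S away-v v-misses) (Switched.elsewhere-misses S away-w w-misses)
      (Switched.keeps-misses S δ≢β δ≢α p-misses)
      (Switched.elsewhere S away-w (inc₁ kJ)) (Switched.others S fe≢β fe≢α)

  private variable
    l : E
    p' s s' : V

  -- If `w` and `p` lie on different chains, a switch at `p` makes it miss `β`, the case of
  -- `gain-if-β`. The chain joining them then leaves every third vertex free to exchange `β` and
  -- `δ`.
  linked-to-p : Spur f e h u v w α β k p δ → (Connected f β δ w p → Gain f e) → Gain f e
  linked-to-p {f = f} {β = β} {p = p} {δ = δ} X use = by-linkage (connected? (proper valid) (≢-sym δ≢β) (inj₁ w-misses) p)
    where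
    open Spur X
    S = switch valid β-other δ-other (≢-sym δ≢β) p-misses
    by-linkage : Dec (Connected f β δ _ p) → Gain f _
    by-linkage (yes w~p) = use w~p
    by-linkage (no away) = gain-keeping (Switched.keeping S)
      (gain-if-β
        (keep-frame (Switched.keeping S) (Switched.keeps-misses S α≢β (≢-sym δ≢α) v-misses)
          (Switched.elsewhere-misses S (away ∘ connected-sym) w-misses))
        kJ
        (trans (Switched.others S (fe≢β ∘ trans (sym k-colour)) (fe≢δ ∘ trans (sym k-colour)))
          (trans k-colour (sym (Switched.others S fe≢β fe≢δ))))
        (Switched.now-miss S))

  shift-δ-to-β : Spur f e h u v w α β k p δ → Misses f r δ → r ≢ w → r ≢ p →
    ((S : Switched f β δ r) → Spur (Switched.result S) e h u v w α β k p δ →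
      ¬ Connected f β δ r w → ¬ Connected f β δ r p → Gain (Switched.result S) e) →
    Gain f e
  shift-δ-to-β X r-miss r≢w r≢p use = linked-to-p X λ w~p →
    let away-w , away-p = separated valid (≢-sym δ≢β) (inj₁ w-misses) (inj₂ p-misses) (inj₂ r-miss)
                            (≢-sym p≢w) (≢-sym r≢w) (≢-sym r≢p) w~p
        S = switch valid β-other δ-other (≢-sym δ≢β) r-miss
    in gain-keeping (Switched.keeping S) (use S (switched-βδ S away-w away-p) away-w away-p)
    where open Spur X

  shift-β-to-δ : Spur f e h u v w α β k p δ → Misses f r β → r ≢ w → r ≢ p →
    ((S : Switched f δ β r) → Spur (Switched.result S) e h u v w α β k p δ →
      ¬ Connected f δ β r w → ¬ Connected f δ β r p → Gain (Switched.result S) e) →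
    Gain f e
  shift-β-to-δ X r-miss r≢w r≢p use = linked-to-p X λ w~p →
    let away-w , away-p = separated valid δ≢β (inj₂ w-misses) (inj₁ p-misses) (inj₂ r-miss)
                            (≢-sym p≢w) (≢-sym r≢w) (≢-sym r≢p) (connected-swap w~p)
        S = switch valid δ-other β-other δ≢β r-miss
    in gain-keeping (Switched.keeping S) (use S (switched-δβ S away-w away-p) away-w away-p)
    where open Spur X

  -- A way to regain `l` when it is a target that has to give up `c`: the `δ`-edge at `w` leads to a
  -- vertex that can take `c`. The vertex `u` cannot, since `e` is about to bring `c` there.
  record Exit (f : Colouring G) (u w : V) (δ : ℕ) (l : E) : Set where
    field
      l-target : Target l
      edge     : E
      tip      : V
      eJ       : Joins edge w tip
      colour   : f edge ≡ δ
      tip-misses : Misses f tip c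
      tip≢u    : tip ≢ u

  keep-exit : Exit f u w δ l → Keeps f f₁ → (∀ {e'} → Inc w e' → f₁ e' ≡ f e') → Exit f₁ u w δ l
  keep-exit X K at-w = record
    { l-target = l-target ; edge = edge ; tip = tip ; eJ = eJ ; colour = trans (at-w (inc₁ eJ)) colour
    ; tip-misses = keeps-misses-c K tip-misses ; tip≢u = tip≢u }
    where open Exit X

  -- If recolouring l costs a target edge, then afterwards l is itself a bad target edge whose path
  -- p' p w tip leads to a vertex missing c, and l can be regained.
  gain-through-p-a : Spur f e h u v w α β k p δ → Joins l p p' → f l ≡ c → ¬ Target l ⊎ Exit f u w δ l →
    Misses f p' (f e) → Gain f e
  gain-through-p-a {f} {e} {h} {u} {v} {w} {α} {β} {k} {p} {δ} {l} {p'} X lJ l-colour exit p'-miss =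
    by-exit exit
    where
    open Spur X hiding (valid)
    path : Alternating f (f e) c u (e ∷ h ∷ k ∷ l ∷ [])
    path = move uv refl (move vw h-colour (move kJ k-colour (move lJ l-colour (stop p'-miss))))
    by-exit : ¬ Target l ⊎ Exit f u w δ l → Gain f e
    by-exit (inj₁ l-off) = flip-gain path (here refl) λ where
      (here refl) e≡c → contradiction e≡c e≢c
      (there (here refl)) _ → h-not-target
      (there (there (here refl))) k≡c → contradiction k≡c k≢c
      (there (there (there (here refl)))) _ → l-off
    by-exit (inj₂ Y) = gain-exchange reach keeps target (to-right (here refl) refl)
      (BadEnd.gain-sliding-h bad-end′ eJ
        (trans (others (≢-sym fe≢δ ∘ trans (sym colour)) (proj₂ δ-other ∘ trans (sym colour))) colour)
        δ-other (keeps-misses (≢-sym fe≢δ) (proj₂ δ-other) p-misses) tip-misses′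
        λ { refl → tip-misses l (inc₂ lJ) l-colour })
      where
      open Exit Y
      open PathFlip (path-flip (Spur.valid X) (proj₁ e-other) c-free e≢c path u-misses)
      keeps : Target e' → e' ≢ l → f e' ≡ c → result e' ≡ c
      keeps te' e'≢l fe'≡c = trans (unflipped λ where
        (here refl) → e≢c fe'≡c
        (there (here refl)) → h-not-target te'
        (there (there (here refl))) → k≢c fe'≡c
        (there (there (there (here e'≡l)))) → e'≢l e'≡l) fe'≡c
      bad-end′ : BadEnd result l k p' p w
      bad-end′ = record
        { valid = valid ; target = l-target ; uv = joins-sym lJ ; vw = joins-sym kJ
        ; h-colour = to-right (there (there (here refl))) k-colour
        ; u-misses = misses-right (there (there (there (here refl)))) (inc₂ lJ) p'-miss }
      -- The path edges coloured `c` after the flip are those coloured `f e` before, namely `e` and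
      -- `k`; neither meets `tip`.
      tip-not-on : e' ∈ e ∷ h ∷ k ∷ l ∷ [] → Inc tip e' → f e' ≢ f e
      tip-not-on (here refl) i _ with ends uv i
      ... | inj₁ tip≡u = tip≢u tip≡u
      ... | inj₂ refl = tip-misses h (inc₁ vw) h-colour
      tip-not-on (there (here refl)) i h≡fe = e≢c (trans (sym h≡fe) h-colour)
      tip-not-on (there (there (here refl))) i _ with ends kJ i
      ... | inj₁ tip≡w = joins-distinct eJ (sym tip≡w)
      ... | inj₂ tip≡p = far-ends-differ eJ kJ (λ { refl → fe≢δ (trans (sym k-colour) colour) }) tip≡p
      tip-not-on (there (there (there (here refl)))) i l≡fe = e≢c (trans (sym l≡fe) l-colour)
      tip-misses′ : Misses result tip c
      tip-misses′ e' i re'≡c with e' ∈? (e ∷ h ∷ k ∷ l ∷ [])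
      ... | no e'∉  = tip-misses e' i (trans (sym (unflipped e'∉)) re'≡c)
      ... | yes e'∈ = tip-not-on e'∈ i (from-left e'∈ re'≡c)

  -- Both ends of `l` miss `δ`, so `l` can take it; then `p` misses `c` and the chain `e`, `h`, `k`
  -- ends there. If `l` is a target, flipping this chain gives `k` colour `c`, and `l`, `k` and the
  -- exit edge form a chain of `δ` and `c` whose flip restores `l`.
  gain-through-p-δ : Spur f e h u v w α β k p δ → Joins l p p' → f l ≡ c → ¬ Target l ⊎ Exit f u w δ l →
    Misses f p' δ → Gain f e
  gain-through-p-δ {f} {e} {h} {u} {v} {w} {α} {β} {k} {p} {δ} {l} {p'} X lJ l-colour exit p'-miss =
    by-exit exit
    where
    open Spur X hiding (valid)
    R = recolour (Spur.valid X) lJ (subst Free (sym l-colour) c-free) (proj₁ δ-other)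
          (λ l≡δ → proj₂ δ-other (trans (sym l≡δ) l-colour)) p-misses p'-miss
    open Recolouring R using (recoloured; unchanged; freed; still-misses)
      renaming (result to fₗ; reach to reach₁; valid to valid₁)
    l-avoids = c-edge-avoids lJ l-colour p≢v p≢w
    bad-end₁ : BadEnd fₗ e h u v w
    bad-end₁ = after-recolouring R (proj₂ δ-other) (proj₁ l-avoids)
    e-same : fₗ e ≡ f e
    e-same = unchanged λ { refl → e≢c l-colour }
    k-same : fₗ k ≡ f e
    k-same = trans (unchanged λ { refl → k≢c l-colour }) k-colour
    p-freed : Misses fₗ p c
    p-freed = subst (Misses fₗ p) l-colour (freed (inc₁ lJ))
    p'-freed : Misses fₗ p' c
    p'-freed = subst (Misses fₗ p') l-colour (freed (inc₂ lJ))
    by-exit : ¬ Target l ⊎ Exit f u w δ l → Gain f e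
    by-exit (inj₁ l-off) = gain-after reach₁
      (λ te' fe'≡c → trans (unchanged λ { refl → l-off te' }) fe'≡c)
      (BadEnd.gain-past-w bad-end₁ kJ (trans k-same (sym e-same)) p-freed)
    by-exit (inj₂ Y) = gain-exchange (reach₁ ◅◅ reach) keeps target (to-right (here refl) e-same)
      (BadEnd.gain-past-w bad-end₂ eJ (trans edge-δ (sym l-δ)) tip-misses′)
      where
      open Exit Y
      path : Alternating fₗ (f e) c u (e ∷ h ∷ k ∷ [])
      path = move uv e-same (move vw (BadEnd.h-colour bad-end₁) (move kJ k-same (stop p-freed)))
      open PathFlip (path-flip valid₁ (proj₁ e-other) c-free e≢c path (BadEnd.u-misses bad-end₁))
      keeps : Target e' → e' ≢ l → f e' ≡ c → result e' ≡ c
      keeps te' e'≢l fe'≡c = trans (unflipped λ where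
        (here refl) → e≢c fe'≡c
        (there (here refl)) → h-not-target te'
        (there (there (here refl))) → k≢c fe'≡c) (trans (unchanged e'≢l) fe'≡c)
      kept : ∀ {z} → z ≢ u → z ≢ v → z ≢ w → z ≢ p → Misses fₗ z c → Misses result z c
      kept z≢u z≢v z≢w z≢p miss e' i re'≡c with e' ∈? (e ∷ h ∷ k ∷ [])
      ... | no e'∉ = miss e' i (trans (sym (unflipped e'∉)) re'≡c)
      ... | yes (here refl) = [ z≢u , z≢v ]′ (ends uv i)
      ... | yes (there (here refl)) = [ z≢v , z≢w ]′ (ends vw i)
      ... | yes (there (there (here refl))) = [ z≢w , z≢p ]′ (ends kJ i)
      l-δ : result l ≡ δ
      l-δ = trans (unflipped λ where
        (here refl) → e≢c l-colour
        (there (here refl)) → proj₁ l-avoids refl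
        (there (there (here refl))) → k≢c l-colour) recoloured
      edge-δ : result edge ≡ δ
      edge-δ = trans (unflipped λ where
        (here refl) → fe≢δ colour
        (there (here refl)) → proj₂ δ-other (trans (sym colour) h-colour)
        (there (there (here refl))) → fe≢δ (trans (sym k-colour) colour))
        (trans (unchanged λ { refl → proj₂ δ-other (trans (sym colour) l-colour) }) colour)
      bad-end₂ : BadEnd result l k p' p w
      bad-end₂ = record
        { valid = valid ; target = l-target ; uv = joins-sym lJ ; vw = joins-sym kJ
        ; h-colour = to-right (there (there (here refl))) k-same
        ; u-misses = kept (λ { refl → u-misses l (inc₂ lJ) l-colour }) (proj₁ (proj₂ l-avoids))
            (proj₂ (proj₂ l-avoids)) (≢-sym (joins-distinct lJ)) p'-freed }
      tip-misses′ : Misses result tip c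
      tip-misses′ = kept tip≢u (λ { refl → tip-misses h (inc₁ vw) h-colour }) (≢-sym (joins-distinct eJ))
        (far-ends-differ eJ kJ (λ { refl → fe≢δ (trans (sym k-colour) colour) }))
        (still-misses (proj₂ δ-other) tip-misses)

  gain-through-p-β : Spur f e h u v w α β k p δ → Joins l p p' → f l ≡ c → ¬ Target l ⊎ Exit f u w δ l →
    Misses f p' β → Gain f e
  gain-through-p-β X lJ l-colour exit p'-miss =
    shift-β-to-δ X p'-miss (proj₂ (proj₂ l-avoids)) (≢-sym (joins-distinct lJ)) λ S X′ away-w away-p →
      gain-through-p-δ X′ lJ (Keeps.keeps (Switched.keeping S) l-colour)
        (Sum.map₂ (λ Y → keep-exit Y (Switched.keeping S) (Switched.elsewhere S away-w)) exit)
        (Switched.now-miss S)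
    where
    open Spur X
    l-avoids = c-edge-avoids lJ l-colour p≢v p≢w

  gain-through-p-α : Spur f e h u v w α β k p δ → Joins l p p' → f l ≡ c → ¬ Target l ⊎ Exit f u w δ l →
    Misses f p' α → Gain f e
  gain-through-p-α X lJ l-colour exit p'-miss =
    shift-α-to-β p'-miss (proj₁ (proj₂ l-avoids)) (proj₂ (proj₂ l-avoids)) λ S _ away-w away-v →
      gain-through-p-β (switched-βα S away-w away-v) lJ (Keeps.keeps (Switched.keeping S) l-colour)
        (Sum.map₂ (λ Y → keep-exit Y (Switched.keeping S) (Switched.elsewhere S away-w)) exit)
        (Switched.now-miss S)
    where
    open Spur X
    l-avoids = c-edge-avoids lJ l-colour p≢v p≢w

  -- Counting the colours missed at a vertex

  -- These are `c` colours, available for every `t ≥ 5`: just enough for one more colour, or one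
  -- edge less, to force a missing one.
  others-of-c : List ℕ
  others-of-c = 5 ∷ range (ℕ.pred c)

  pred-c<c : ℕ.pred c < c
  pred-c<c = ℕₚ.≤-reflexive (ℕₚ.suc-pred c {{ℕ.>-nonZero 1≤c}})

  length-others : length others-of-c ≡ c
  length-others = trans (cong suc (length-range (ℕ.pred c))) (ℕₚ.suc-pred c {{ℕ.>-nonZero 1≤c}})

  ∈-others⇒Other : κ ∈ others-of-c → Other κ
  ∈-others⇒Other (here refl) =
    ((s≤s z≤n , 5≤t) , inj₂ ℕₚ.≤-refl) , λ 5≡c → ℕₚ.<⇒≱ (s≤s c≤4) (ℕₚ.≤-reflexive 5≡c)
  ∈-others⇒Other (there κ∈) with 1≤κ , κ≤ ← range-≤ κ∈ =
    ((1≤κ , ℕₚ.≤-trans κ≤c (proj₂ (proj₁ c-free))) , inj₁ κ≤c) , λ { refl → ℕₚ.<⇒≱ pred-c<c κ≤ }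
    where κ≤c = ℕₚ.≤-trans κ≤ ℕₚ.pred[n]≤n

  others-unique : Unique others-of-c
  others-unique = All.tabulate (λ κ∈ 5≡κ → ℕₚ.<⇒≱ (s≤s c≤4)
      (ℕₚ.≤-trans (ℕₚ.≤-reflexive 5≡κ) (ℕₚ.≤-trans (proj₂ (range-≤ κ∈)) ℕₚ.pred[n]≤n)))
    ∷ Uniqueₚ.map⁺ ℕₚ.suc-injective (Uniqueₚ.upTo⁺ _)

  missed-or-all-seen : ∀ f z (cs : List ℕ) →
    (∃ λ κ → κ ∈ cs × Misses f z κ) ⊎ (∀ {κ} → κ ∈ cs → Sees f z κ)
  missed-or-all-seen f z [] = inj₂ λ ()
  missed-or-all-seen f z (κ ∷ cs) with sees-or-misses f z κ | missed-or-all-seen f z cs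
  ... | inj₂ miss | _                      = inj₁ (κ , here refl , miss)
  ... | inj₁ _    | inj₁ (κ' , κ'∈ , miss) = inj₁ (κ' , there κ'∈ , miss)
  ... | inj₁ see  | inj₂ all               = inj₂ λ { (here refl) → see ; (there κ'∈) → all κ'∈ }

  g-positive : ∀ e → 1 ≤ g e
  g-positive e = proj₁ (proj₁ g-proper e)

  -- Edges at one vertex differ in their `g`-colours, so at most `k` of them have a `g`-colour up to
  -- `k`.
  seen-≤ : ∀ {cs k} → Valid f → Unique cs →
    (∀ {κ} → κ ∈ cs → ∃ λ e → Inc z e × f e ≡ κ × g e ≤ k) → length cs ≤ k
  seen-≤ {f} {z} {k = k} f-valid unique seen = subst (_ ≤_) (length-range k)
    (unique-length-≤ {R = λ κ i → ∃ λ e → Inc z e × f e ≡ κ × g e ≡ i}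
      (λ { (e , i , refl , ge) (e' , i' , refl , ge') →
        cong f (colour-unique (proj₂ g-proper) i i' (trans ge (sym ge'))) })
      unique (range k)
      (λ κ∈ → let e , i , fe≡κ , ge≤k = seen κ∈ in g e , ∈-range (g-positive e) ge≤k , e , i , fe≡κ , refl))

  all-seen-≤ : ∀ {cs} → Valid f → Unique cs → (∀ {κ} → κ ∈ cs → Free κ) →
    (∀ {κ} → κ ∈ cs → Sees f z κ) → length cs ≤ c
  all-seen-≤ f-valid unique free seen = seen-≤ f-valid unique λ κ∈ →
    let e , _ , j , fe≡κ = seen κ∈ in e , inc₁ j , fe≡κ , free⇒active f-valid (subst Free (sym fe≡κ) (free κ∈))

  -- With `κ` there would be `c + 1` free colours on at most `c` edges that are not frozen.
  missed-other-with : ∀ κ → Free κ → κ ∉ others-of-c → Valid f → Sees f z κ →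
    ∃ λ κ' → Other κ' × Misses f z κ'
  missed-other-with {f} {z} κ κ-free κ∉ f-valid sees with missed-or-all-seen f z others-of-c
  ... | inj₁ (κ' , κ'∈ , miss) = κ' , ∈-others⇒Other κ'∈ , miss
  ... | inj₂ all = contradiction
          (all-seen-≤ {cs = κ ∷ others-of-c} f-valid
            (All.tabulate (λ { κ'∈ refl → κ∉ κ'∈ }) ∷ others-unique)
            (λ { (here refl) → κ-free ; (there κ'∈) → proj₁ (∈-others⇒Other κ'∈) })
            (λ { (here refl) → sees ; (there κ'∈) → all κ'∈ }))
          (ℕₚ.<⇒≱ (s≤s (ℕₚ.≤-reflexive (sym length-others))))

  missed-other-at-c : Valid f → Sees f z c → ∃ λ κ → Other κ × Misses f z κ
  missed-other-at-c = missed-other-with c c-free (λ c∈ → proj₂ (∈-others⇒Other c∈) refl)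

  -- An edge at `z` in one of the `c` other colours is then no target, so its `g`-colour is below
  -- `c`: there are at most `c - 1` such edges.
  missed-other-if-good : Valid f → (∀ {e} → Inc z e → Target e → f e ≡ c) → ∃ λ κ → Other κ × Misses f z κ
  missed-other-if-good {f} {z} f-valid good with missed-or-all-seen f z others-of-c
  ... | inj₁ (κ' , κ'∈ , miss) = κ' , ∈-others⇒Other κ'∈ , miss
  ... | inj₂ all = contradiction (seen-≤ f-valid others-unique seen)
          (ℕₚ.<⇒≱ (subst (ℕ.pred c <_) (sym length-others) pred-c<c))
    where
    seen : ∀ {κ} → κ ∈ others-of-c → ∃ λ e → Inc z e × f e ≡ κ × g e ≤ ℕ.pred c
    seen κ∈ with all κ∈
    ... | e , _ , j , refl = e , inc₁ j , refl , ℕₚ.≤-pred (subst (g e <_)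
            (sym (ℕₚ.suc-pred c {{ℕ.>-nonZero 1≤c}})) (ℕₚ.≤∧≢⇒<
              (free⇒active f-valid (proj₁ (∈-others⇒Other κ∈)))
              (λ te → proj₂ (∈-others⇒Other κ∈) (good (inc₁ j) te))))

  -- Without a target, four edges at `z` would have distinct `g`-colours among 1, 2, 3, because
  -- `c ≤ 4`.
  some-target : ∀ {es} → Valid f → Unique es → (∀ {e} → e ∈ es → Inc z e × Free (f e)) →
    4 ≤ length es → ∃ λ e → e ∈ es × Target e
  some-target {f} {es = es} f-valid unique local four with Any.any? (λ e → g e ℕ.≟ c) es
  ... | yes found = find found
  ... | no none = contradiction
          (ℕₚ.≤-trans four (unique-length-≤ {R = λ e i → (e ∈ es) × g e ≡ i}
            (λ { (e∈ , ge) (e'∈ , ge') → colour-unique (proj₂ g-proper) (proj₁ (local e∈))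
                   (proj₁ (local e'∈)) (trans ge (sym ge')) })
            unique (range 3)
            (λ {e} e∈ → g e , ∈-range (g-positive e) (ℕₚ.≤-pred (ℕₚ.<-≤-trans
                (ℕₚ.≤∧≢⇒< (free⇒active f-valid (proj₂ (local e∈))) (λ te → none (lose e∈ te))) c≤4))
              , e∈ , refl)))
          λ { (s≤s (s≤s (s≤s ()))) }

  -- The bad case for five colours

  module FiveColours (t≡5 : t ≡ 5) where

    exhausted : Spur f e h u v w α β k p δ → Other κ → κ ≡ α ⊎ κ ≡ β ⊎ κ ≡ f e ⊎ κ ≡ δ
    exhausted {f} {e} {α = α} {β = β} {δ = δ} {κ = κ} X κ-other
      with κ ℕ.≟ α | κ ℕ.≟ β | κ ℕ.≟ f e | κ ℕ.≟ δ
    ... | yes κ≡α | _ | _ | _ = inj₁ κ≡α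
    ... | no _ | yes κ≡β | _ | _ = inj₂ (inj₁ κ≡β)
    ... | no _ | no _ | yes κ≡fe | _ = inj₂ (inj₂ (inj₁ κ≡fe))
    ... | no _ | no _ | no _ | yes κ≡δ = inj₂ (inj₂ (inj₂ κ≡δ))
    ... | no κ≢α | no κ≢β | no κ≢fe | no κ≢δ =
      contradiction (unique-length-≤ {R = _≡_} (λ p q → trans p (sym q)) unique (range 5)
        (λ {κ'} κ'∈ → κ' , bounded (All.lookup free κ'∈) , refl)) λ { (s≤s (s≤s (s≤s (s≤s (s≤s ()))))) }
      where
      open Spur X
      bounded : ∀ {κ'} → Free κ' → κ' ∈ range 5
      bounded ((1≤κ' , κ'≤t) , _) = ∈-range 1≤κ' (subst (_ ≤_) t≡5 κ'≤t)
      free : All Free (κ ∷ c ∷ δ ∷ f e ∷ α ∷ β ∷ [])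
      free = proj₁ κ-other ∷ c-free ∷ proj₁ δ-other ∷ proj₁ e-other ∷ proj₁ α-other ∷ proj₁ β-other ∷ []
      unique : Unique (κ ∷ c ∷ δ ∷ f e ∷ α ∷ β ∷ [])
      unique = (proj₂ κ-other ∷ κ≢δ ∷ κ≢fe ∷ κ≢α ∷ κ≢β ∷ [])
        ∷ (≢-sym (proj₂ δ-other) ∷ ≢-sym e≢c ∷ ≢-sym (proj₂ α-other) ∷ ≢-sym (proj₂ β-other) ∷ [])
        ∷ (≢-sym fe≢δ ∷ δ≢α ∷ δ≢β ∷ [])
        ∷ (fe≢α ∷ fe≢β ∷ [])
        ∷ (α≢β ∷ [])
        ∷ [] ∷ []

    gain-through-p : Spur f e h u v w α β k p δ → Joins l p p' → f l ≡ c → ¬ Target l ⊎ Exit f u w δ l → Gain f e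
    gain-through-p X lJ l-colour exit with missed-other-at-c (Spur.valid X) (_ , _ , joins-sym lJ , l-colour)
    ... | κ , κ-other , miss with exhausted X κ-other
    ... | inj₁ refl               = gain-through-p-α X lJ l-colour exit miss
    ... | inj₂ (inj₁ refl)        = gain-through-p-β X lJ l-colour exit miss
    ... | inj₂ (inj₂ (inj₁ refl)) = gain-through-p-a X lJ l-colour exit miss
    ... | inj₂ (inj₂ (inj₂ refl)) = gain-through-p-δ X lJ l-colour exit miss

    -- As `k₂` is the target at `s`, the `c`-edge at `s` is expendable. By `p-good` its other end is
    -- not `p`, so a colour `δ` missed there can be exchanged for `β`.
    gain-target-α : ∀ {k₂} → Spur f e h u v w α β k p δ → Joins k₂ w s → f k₂ ≡ α → Target k₂ →
      (∀ {e'} → Inc p e' → f e' ≡ c → Target e') → Gain f e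
    gain-target-α {f} {e} {h} {u} {v} {w} {α} {β} {k} {p} {δ} {s} {k₂} X k₂J k₂≡α k₂-target p-good =
      by-c-edge (sees-or-misses f s c)
      where
      open Spur X
      k₂≢c : f k₂ ≢ c
      k₂≢c k₂≡c = proj₂ α-other (trans (sym k₂≡α) k₂≡c)
      s≢u : s ≢ u
      s≢u refl = fe≢α (trans (cong f (target-unique (inc₁ uv) (inc₂ k₂J) target k₂-target)) k₂≡α)
      s≢p : s ≢ p
      s≢p = far-ends-differ k₂J kJ λ { refl → fe≢α (trans (sym k-colour) k₂≡α) }
      by-c-edge : Sees f s c ⊎ Misses f s c → Gain f e
      by-c-edge (inj₂ miss) = gain-sliding-h k₂J k₂≡α α-other v-misses miss s≢u
      by-c-edge (inj₁ (l , s' , lJ , l-colour)) = by-s (missed-other-at-c valid (_ , _ , lJ , l-colour))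
        where
        spoke : Spoke f u w α k₂ l s s'
        spoke = record { kJ = k₂J ; k-colour = k₂≡α ; s≢u = s≢u ; lJ = lJ ; l-colour = l-colour
          ; l-off = λ lt → k₂≢c (trans (cong f (target-unique (inc₂ k₂J) (inc₁ lJ) k₂-target lt)) l-colour) }
        s-apart = neighbour-of-w k₂J k₂≢c
        s'-apart = proj₂ (c-edge-avoids lJ l-colour (proj₁ s-apart) (proj₂ s-apart))
        s'≢p : s' ≢ p
        s'≢p refl = Spoke.l-off spoke (p-good (inc₂ lJ) l-colour)

        by-s' : Misses f s (f e) → ∃ (λ κ → Other κ × Misses f s' κ) → Gain f e
        by-s' s-miss (κ , κ-other , miss) with exhausted X κ-other
        ... | inj₁ refl = shift-α-to-β miss (proj₁ s'-apart) (proj₂ s'-apart) λ S F away-w _ →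
                gain-at-α-edge F (keep-spoke spoke (Switched.keeping S) (Switched.elsewhere S away-w (inc₁ k₂J)))
                  e-other fe≢β (Switched.keeps-misses S fe≢β fe≢α s-miss) (Switched.now-miss S)
        ... | inj₂ (inj₁ refl) = gain-at-α-edge frame spoke e-other fe≢β s-miss miss
        ... | inj₂ (inj₂ (inj₁ refl)) = gain-freeing-s bad-end α-other v-misses spoke e-other s-miss miss
        ... | inj₂ (inj₂ (inj₂ refl)) = shift-δ-to-β X miss (proj₂ s'-apart) s'≢p λ S X′ away-w _ →
                gain-at-α-edge (Spur.frame X′)
                  (keep-spoke spoke (Switched.keeping S) (Switched.elsewhere S away-w (inc₁ k₂J)))
                  e-other fe≢β (Switched.keeps-misses S fe≢β fe≢δ s-miss) (Switched.now-miss S)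

        by-s : ∃ (λ κ → Other κ × Misses f s κ) → Gain f e
        by-s (κ , κ-other , miss) with exhausted X κ-other
        ... | inj₁ refl = contradiction k₂≡α (miss k₂ (inc₂ k₂J))
        ... | inj₂ (inj₁ refl) = gain-recolouring-α frame k₂J k₂≡α miss
        ... | inj₂ (inj₂ (inj₁ refl)) = by-s' miss (missed-other-at-c valid (_ , _ , joins-sym lJ , l-colour))
        ... | inj₂ (inj₂ (inj₂ refl)) = shift-δ-to-β X miss (proj₂ s-apart) s≢p λ S X′ away-w _ →
                gain-recolouring-α (Spur.frame X′) k₂J
                  (trans (Switched.elsewhere S away-w (inc₁ k₂J)) k₂≡α) (Switched.now-miss S)

    -- Once `k₃` has colour `β`, the vertex `w` misses `δ`, as `p` does: `gain-if-β` applies with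
    -- `δ` in place of `β`.
    gain-recolouring-δ : ∀ {k₃} → Spur f e h u v w α β k p δ → Joins k₃ w q → f k₃ ≡ δ → Misses f q β → Gain f e
    gain-recolouring-δ {f} {e} {w = w} {k = k} {k₃ = k₃} X k₃J k₃≡δ q-miss = gain-keeping K
      (gain-if-β
        record { bad-end = keep-bad-end bad-end K ; α-other = α-other ; β-other = δ-other ; α≢β = ≢-sym δ≢α
               ; v-misses = still-misses (≢-sym α≢β) v-misses
               ; w-misses = subst (Misses result w) k₃≡δ (freed (inc₁ k₃J)) }
        kJ
        (trans (unchanged λ { refl → fe≢δ (trans (sym k-colour) k₃≡δ) })
          (trans k-colour (sym (unchanged λ { refl → fe≢δ k₃≡δ }))))
        (still-misses (≢-sym δ≢β) p-misses))
      where
      open Spur X hiding (valid)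
      open Recolouring (recolour (Spur.valid X) k₃J (subst Free (sym k₃≡δ) (proj₁ δ-other)) (proj₁ β-other)
        (λ k₃≡β → δ≢β (trans (sym k₃≡δ) k₃≡β)) w-misses q-miss)
      K = keeping (λ k₃≡c → proj₂ δ-other (trans (sym k₃≡δ) k₃≡c)) (proj₂ β-other)

    gain-target-δ : ∀ {k₃ q'} → Spur f e h u v w α β k p δ → Joins k₃ w q → f k₃ ≡ δ →
      Joins l q q' → f l ≡ c → ¬ Target l → Gain f e
    gain-target-δ {f} {e} {h} {u} {v} {w} {α} {β} {k} {p} {δ} {q} {l} {k₃} X k₃J k₃≡δ lJ l-colour l-off
      with missed-other-at-c (Spur.valid X) (_ , _ , lJ , l-colour)
    ... | κ , κ-other , miss with exhausted X κ-other
    ... | inj₁ refl = shift-α-to-β miss (proj₁ q-apart) (proj₂ q-apart) λ S _ away-w away-v →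
            gain-recolouring-δ (switched-βα S away-w away-v) k₃J
              (trans (Switched.elsewhere S away-w (inc₁ k₃J)) k₃≡δ) (Switched.now-miss S)
      where
      open Spur X
      q-apart = neighbour-of-w k₃J λ k₃≡c → proj₂ δ-other (trans (sym k₃≡δ) k₃≡c)
    ... | inj₂ (inj₁ refl) = gain-recolouring-δ X k₃J k₃≡δ miss
    ... | inj₂ (inj₂ (inj₂ refl)) = contradiction k₃≡δ (miss k₃ (inc₂ k₃J))
    -- Now `p`, `w`, `q` form a whole chain of `f e` and `δ`. After its flip `k₃` has colour `f e`
    -- and `q` misses `δ`, so `q` replaces `p`, and its `c`-edge `l` is no target.
    ... | inj₂ (inj₂ (inj₁ refl)) = gain-keeping K (gain-through-p spur′ lJ (Keeps.keeps K l-colour) (inj₁ l-off))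
      where
      open Spur X hiding (valid)
      open PathFlip (path-flip (Spur.valid X) (proj₁ e-other) (proj₁ δ-other) fe≢δ
        (move (joins-sym kJ) k-colour (move k₃J k₃≡δ (stop miss))) p-misses)
      K : Keeps f result
      K = record { valid = valid ; reach = reach
        ; keeps = λ fe'≡c → trans (others (λ x → e≢c (trans (sym x) fe'≡c))
                    (λ x → proj₂ δ-other (trans (sym x) fe'≡c))) fe'≡c
        ; reflects = λ re'≡c → trans (sym (others⁻ (λ x → e≢c (trans (sym x) re'≡c))
                    (λ x → proj₂ δ-other (trans (sym x) re'≡c)))) re'≡c }
      spur′ : Spur result e h u v w α β k₃ q δ
      spur′ = record
        { frame = keep-frame K (keeps-misses (≢-sym fe≢α) (≢-sym δ≢α) v-misses)
            (keeps-misses (≢-sym fe≢β) (≢-sym δ≢β) w-misses)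
        ; kJ = k₃J
        ; k-colour = trans (to-left (there (here refl)) k₃≡δ) (sym (unflipped λ where
            (here refl) → e-not-at-w (inc₁ kJ)
            (there (here refl)) → e-not-at-w (inc₁ k₃J)))
        ; δ-other = δ-other ; δ≢α = δ≢α ; δ≢β = δ≢β
        ; p-misses = misses-right (there (here refl)) (inc₂ k₃J) miss }

    gain-at-bad-end : BadEnd f e h u v w → Gain f e
    gain-at-bad-end {f} {e} {h} {u} {v} {w} B =
      choose-αβ (missed-other-at-c valid (_ , _ , vw , h-colour))
                (missed-other-at-c valid (_ , _ , joins-sym vw , h-colour))
      where
      open BadEnd B

      by-target : Spur f e h u v w α β k p δ → Joins l p p' → f l ≡ c → Target l →
        Sees f w α → Sees f w δ → Gain f e
      by-target {α} {β} {k} {p} {δ} {l} X lJ l-colour l-target (k₂ , s , k₂J , k₂≡α) (k₃ , q , k₃J , k₃≡δ) =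
        by-edge (some-target valid unique local ℕₚ.≤-refl)
        where
        open Spur X using (α-other; δ-other; δ≢α; kJ; k-colour; k≢c; fe≢α; fe≢δ)
        unique : Unique (h ∷ k ∷ k₂ ∷ k₃ ∷ [])
        unique = ((λ { refl → k≢c h-colour }) ∷ (λ { refl → proj₂ α-other (trans (sym k₂≡α) h-colour) })
            ∷ (λ { refl → proj₂ δ-other (trans (sym k₃≡δ) h-colour) }) ∷ [])
          ∷ ((λ { refl → fe≢α (trans (sym k-colour) k₂≡α) })
            ∷ (λ { refl → fe≢δ (trans (sym k-colour) k₃≡δ) }) ∷ [])
          ∷ ((λ { refl → δ≢α (trans (sym k₃≡δ) k₂≡α) }) ∷ [])
          ∷ [] ∷ []
        local : ∀ {e'} → e' ∈ h ∷ k ∷ k₂ ∷ k₃ ∷ [] → Inc w e' × Free (f e')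
        local (here refl) = inc₂ vw , subst Free (sym h-colour) c-free
        local (there (here refl)) = inc₁ kJ , subst Free (sym k-colour) (proj₁ e-other)
        local (there (there (here refl))) = inc₁ k₂J , subst Free (sym k₂≡α) (proj₁ α-other)
        local (there (there (there (here refl)))) = inc₁ k₃J , subst Free (sym k₃≡δ) (proj₁ δ-other)
        -- Neither `h` nor `k` is the target at `w`: `h` meets `e` at `v`, and `k` meets the target
        -- `l` at `p`. That leaves the edges coloured `α` and `δ`.
        by-edge : ∃ (λ e' → e' ∈ h ∷ k ∷ k₂ ∷ k₃ ∷ [] × Target e') → Gain f e
        by-edge (_ , here refl , t) = contradiction t h-not-target
        by-edge (_ , there (here refl) , t) =
          contradiction (trans (cong f (target-unique (inc₂ kJ) (inc₁ lJ) t l-target)) l-colour) k≢c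
        by-edge (_ , there (there (here refl)) , t) = gain-target-α X k₂J k₂≡α t λ i e'≡c →
          subst Target (colour-unique (proper valid) (inc₁ lJ) i (trans l-colour (sym e'≡c))) l-target
        by-edge (_ , there (there (there (here refl))) , t) with sees-or-misses f q c
        ... | inj₁ (_ , _ , l₃J , l₃≡c) = gain-target-δ X k₃J k₃≡δ l₃J l₃≡c λ l₃t →
                proj₂ δ-other (trans (sym k₃≡δ) (trans (cong f (target-unique (inc₂ k₃J) (inc₁ l₃J) t l₃t)) l₃≡c))
        ... | inj₂ miss = gain-through-p X lJ l-colour (inj₂ record
                { l-target = l-target ; edge = k₃ ; tip = q ; eJ = k₃J ; colour = k₃≡δ ; tip-misses = miss
                ; tip≢u = λ { refl → fe≢δ (trans (cong f (target-unique (inc₁ uv) (inc₂ k₃J) target t)) k₃≡δ) } })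

      with-spur : Spur f e h u v w α β k p δ → Joins l p p' → f l ≡ c → Gain f e
      with-spur {α} {δ = δ} {l = l} X lJ l-colour with g l ℕ.≟ c
      ... | no l-off = gain-through-p X lJ l-colour (inj₁ l-off)
      ... | yes l-target with sees-or-misses f w α | sees-or-misses f w δ
      ... | inj₂ miss | _         = gain-recolouring-h (Spur.α-other X) (Spur.v-misses X) miss
      ... | inj₁ _    | inj₂ miss = gain-if-β
              record { bad-end = B ; α-other = Spur.α-other X ; β-other = Spur.δ-other X
                     ; α≢β = ≢-sym (Spur.δ≢α X) ; v-misses = Spur.v-misses X ; w-misses = miss }
              (Spur.kJ X) (Spur.k-colour X) (Spur.p-misses X)
      ... | inj₁ sα   | inj₁ sδ   = by-target X lJ l-colour l-target sα sδ

      with-frame : Frame f e h u v w α β → Gain f e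
      with-frame {α} {β} F with sees-or-misses f w (f e)
      ... | inj₂ miss = gain-at-w miss
      ... | inj₁ (k , p , kJ , k≡fe) with sees-or-misses f p c
      ... | inj₂ miss = gain-past-w kJ k≡fe miss
      ... | inj₁ (l , p' , lJ , l≡c) with missed-other-at-c valid (_ , _ , lJ , l≡c)
      ... | δ , δ-other , miss with δ ℕ.≟ α | δ ℕ.≟ β
      ... | yes refl | _        = gain-if-α F kJ k≡fe miss
      ... | no _     | yes refl = gain-if-β F kJ k≡fe miss
      ... | no δ≢α   | no δ≢β   = with-spur
              record { frame = F ; kJ = kJ ; k-colour = k≡fe ; δ-other = δ-other ; δ≢α = δ≢α ; δ≢β = δ≢β
                     ; p-misses = miss } lJ l≡c

      choose-αβ : ∃ (λ α → Other α × Misses f v α) → ∃ (λ β → Other β × Misses f w β) → Gain f e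
      choose-αβ (α , α-other , v-miss) (β , β-other , w-miss) with α ℕ.≟ β
      ... | yes refl = gain-recolouring-h α-other v-miss w-miss
      ... | no α≢β = with-frame record { bad-end = B ; α-other = α-other ; β-other = β-other ; α≢β = α≢β
                                       ; v-misses = v-miss ; w-misses = w-miss }

  -- Vizing fans

  -- The class of colour `c` loses exactly the edge `h`.
  record Opened (f : Colouring G) (h : E) : Set where
    field
      result   : Colouring G
      valid    : Valid result
      reach    : f ⇝ result
      opened   : result h ≢ c
      keeps    : e ≢ h → f e ≡ c → result e ≡ c
      reflects : result e ≡ c → f e ≡ c

  opened-after : Keeps f f₁ → Opened f₁ h → Opened f h
  opened-after K O = record
    { result = Opened.result O ; valid = Opened.valid O ; reach = Keeps.reach K ◅◅ Opened.reach O
    ; opened = Opened.opened O ; keeps = λ e≢h → Opened.keeps O e≢h ∘ Keeps.keeps K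
    ; reflects = Keeps.reflects K ∘ Opened.reflects O }

  open-directly : Valid f → Joins h v w → f h ≡ c → Other κ → Misses f v κ → Misses f w κ → Opened f h
  open-directly {f} {h} {κ = κ} f-valid hJ h-colour (κ-free , κ≢c) v-miss w-miss = record
    { result = result ; valid = valid ; reach = reach ; opened = λ h≡c → κ≢c (trans (sym recoloured) h≡c)
    ; keeps = λ e≢h fe≡c → trans (unchanged e≢h) fe≡c ; reflects = reflects }
    where
    open Recolouring (recolour f-valid hJ (subst Free (sym h-colour) c-free) κ-free
      (λ h≡κ → κ≢c (trans (sym h≡κ) h-colour)) v-miss w-miss)
    reflects : result e ≡ c → f e ≡ c
    reflects {e} re≡c with e ≟ h
    ... | yes refl = h-colour
    ... | no e≢h   = trans (sym (unchanged e≢h)) re≡c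

  -- A Vizing fan at v for the edge h. The list holds the pairs (z , β) where the fan goes on from z
  -- along the edge at v whose colour β is missing at z.
  data Fan (f : Colouring G) (v : V) (h : E) : V → E → List (V × ℕ) → Set where
    base   : Joins h v w → f h ≡ c → Fan f v h w h []
    extend : ∀ {ps} → Fan f v h x e ps → Other κ → Misses f x κ → Joins k v z → f k ≡ κ →
             κ ∉ map proj₂ ps → Fan f v h z k ((x , κ) ∷ ps)

  private variable
    ps : List (V × ℕ)

  fan-keeps : Fan f v h x e ps → f₁ h ≡ c →
    (∀ {k} → Inc v k → f k ∈ map proj₂ ps → f₁ k ≡ f k) →
    (∀ {z κ} → (z , κ) ∈ ps → Misses f z κ → Misses f₁ z κ) → Fan f₁ v h x e ps
  fan-keeps (base hJ _) h-colour same misses = base hJ h-colour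
  fan-keeps (extend Φ κ-other miss kJ refl fresh) h-colour same misses = extend
    (fan-keeps Φ h-colour (λ i → same i ∘ there) (misses ∘ there))
    κ-other (misses (here refl) miss) kJ (same (inc₁ kJ) (here refl)) fresh

  fan-h : Fan f v h x e ps → ∃ (Joins h v) × f h ≡ c
  fan-h (base hJ h-colour)      = (_ , hJ) , h-colour
  fan-h (extend Φ _ _ _ _ _) = fan-h Φ

  fan-sees : Fan f v h x e ps → κ ∈ map proj₂ ps → ∃ λ k → Inc v k × f k ≡ κ
  fan-sees (extend Φ _ _ kJ k≡κ _)  (here refl) = _ , inc₁ kJ , k≡κ
  fan-sees (extend Φ _ _ _ _ _)     (there κ∈)  = fan-sees Φ κ∈

  fan-tip : Fan f v h x e ps → Joins e v x × (f e ≡ c ⊎ f e ∈ map proj₂ ps)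
  fan-tip (base hJ h-colour)        = hJ , inj₁ h-colour
  fan-tip (extend _ _ _ kJ refl _) = kJ , inj₂ (here refl)

  -- The fan edges have colour `c` or listed colours, and each colour is fresh when added, so an
  -- earlier edge is never the last one.
  earlier-edge : Fan f v h x e ps → (z , κ) ∈ ps → ∃ λ k → Joins k v z × (f k ≡ c ⊎ f k ∈ map proj₂ ps) × k ≢ e
  earlier-edge {f = f} (extend {e = e₀} Φ κ-other _ _ k≡κ fresh) (here refl) =
    let eJ , seen = fan-tip Φ in e₀ , eJ , Sum.map₂ there seen , λ { refl →
      [ (λ e≡c → proj₂ κ-other (trans (sym k≡κ) e≡c)) , (λ e∈ → fresh (subst (_∈ _) k≡κ e∈)) ]′ seen }
  earlier-edge {f = f} (extend Φ κ-other _ _ k≡κ fresh) (there z∈) =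
    let e' , e'J , seen , _ = earlier-edge Φ z∈ in e' , e'J , Sum.map₂ there seen , λ { refl →
      [ (λ e≡c → proj₂ κ-other (trans (sym k≡κ) e≡c)) , (λ e∈ → fresh (subst (_∈ _) k≡κ e∈)) ]′ seen }

  earlier-differs : Fan f v h x e ps → (z , κ) ∈ ps → z ≢ x
  earlier-differs Φ z∈ =
    let _ , kJ , _ , k≢e = earlier-edge Φ z∈ in far-ends-differ kJ (proj₁ (fan-tip Φ)) k≢e

  -- The fan cut off at the vertex from which it went on along `κ`; this vertex is unique because
  -- listed colours do not repeat.
  record Prefix (f : Colouring G) (v : V) (h : E) (κ : ℕ) (ps : List (V × ℕ)) : Set where
    field
      {tip}      : V
      {tip-edge} : E
      {pairs}    : List (V × ℕ)
      fan        : Fan f v h tip tip-edge pairs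
      tip-misses : Misses f tip κ
      fresh      : κ ∉ map proj₂ pairs
      here-tip   : (tip , κ) ∈ ps
      only-tip   : (z , κ) ∈ ps → z ≡ tip

  prefix : Fan f v h x e ps → κ ∈ map proj₂ ps → Prefix f v h κ ps
  prefix (extend Φ _ miss _ _ fresh) (here refl) = record
    { fan = Φ ; tip-misses = miss ; fresh = fresh ; here-tip = here refl
    ; only-tip = λ { (here refl) → refl ; (there z∈) → contradiction (∈-map⁺ proj₂ z∈) fresh } }
  prefix (extend Φ _ _ _ _ fresh) (there κ∈) = record
    { fan = P.fan ; tip-misses = P.tip-misses ; fresh = P.fresh ; here-tip = there P.here-tip
    ; only-tip = λ { (here refl) → contradiction κ∈ fresh ; (there z∈) → P.only-tip z∈ } }
    where module P = Prefix (prefix Φ κ∈)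

  -- The fan is rotated from its tip backwards. Recolouring the last edge with `κ` frees `β` at `v`,
  -- and the preceding vertex misses `β` as well, so the shorter fan is in the same situation.
  open-by-fan : ∀ ps → Fan f v h x e ps → Valid f → Other κ → Misses f x κ → Misses f v κ → Opened f h
  open-by-fan [] (base hJ h-colour) f-valid κ-other x-miss v-miss =
    open-directly f-valid hJ h-colour κ-other v-miss x-miss
  open-by-fan {f} {v} {h} {e = k} {κ} ((y , β) ∷ ps) (extend Φ β-other miss kJ k≡β fresh) f-valid κ-other x-miss v-miss =
    opened-after K (open-by-fan ps
      (fan-keeps Φ (Keeps.keeps K (proj₂ (fan-h Φ)))
        (λ i β'∈ → unchanged λ { refl → fresh (subst (_∈ map proj₂ ps) k≡β β'∈) })
        (λ z∈ → still-misses (κ≢seen (∈-map⁺ proj₂ z∈))))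
      valid β-other (still-misses κ≢β miss) (subst (Misses result v) k≡β (freed (inc₁ kJ))))
    where
    κ≢β : κ ≢ β
    κ≢β refl = v-miss k (inc₁ kJ) k≡β
    κ≢seen : ∀ {μ} → μ ∈ map proj₂ ps → κ ≢ μ
    κ≢seen μ∈ refl = let e' , i , e'≡κ = fan-sees Φ μ∈ in v-miss e' i e'≡κ
    open Recolouring (recolour f-valid kJ (subst Free (sym k≡β) (proj₁ β-other)) (proj₁ κ-other)
      (λ k≡κ → κ≢β (trans (sym k≡κ) k≡β)) v-miss x-miss)
    K = keeping (λ k≡c → proj₂ β-other (trans (sym k≡β) k≡c)) (proj₂ κ-other)

  -- The vertices `v`, `P.tip` and `x` are ends of chains of `α` and `β`, so not all three share
  -- one. If `P.tip` is apart from `v`, a switch there lets the prefix rotate; otherwise `x` is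
  -- apart from both, and a switch at `x` lets the whole fan rotate.
  open-closed-fan : Fan f v h x e ps → Valid f → Other α → Misses f v α →
    Other β → Misses f x β → β ∈ map proj₂ ps → Opened f h
  open-closed-fan {f} {v} {h} {x} {ps = ps} {α} {β} Φ f-valid α-other v-miss β-other x-miss β∈ =
    by-linkage (connected? (proper f-valid) α≢β (inj₁ v-miss) P.tip)
    where
    module P = Prefix (prefix Φ β∈)
    α≢seen : ∀ {μ} → μ ∈ map proj₂ ps → μ ≢ α
    α≢seen μ∈ refl = let e' , i , e'≡α = fan-sees Φ μ∈ in v-miss e' i e'≡α
    α≢seen-before : ∀ {μ} → μ ∈ map proj₂ P.pairs → μ ≢ α
    α≢seen-before μ∈ refl = let e' , i , e'≡α = fan-sees P.fan μ∈ in v-miss e' i e'≡α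
    α≢β : α ≢ β
    α≢β = ≢-sym (α≢seen β∈)
    by-linkage : Dec (Connected f α β v P.tip) → Opened f h
    by-linkage (no away) = opened-after S.keeping (open-by-fan P.pairs
      (fan-keeps P.fan (Keeps.keeps S.keeping (proj₂ (fan-h Φ)))
        (λ i _ → S.elsewhere (away ∘ connected-sym) i)
        (λ z∈ → S.keeps-misses (α≢seen-before (∈-map⁺ proj₂ z∈)) λ { refl → P.fresh (∈-map⁺ proj₂ z∈) }))
      (Keeps.valid S.keeping) α-other S.now-miss (S.elsewhere-misses (away ∘ connected-sym) v-miss))
      where module S = Switched (switch f-valid α-other β-other α≢β P.tip-misses)
    by-linkage (yes v~tip) = opened-after S.keeping (open-by-fan ps
      (fan-keeps Φ (Keeps.keeps S.keeping (proj₂ (fan-h Φ))) (λ i _ → S.elsewhere away-v i) misses)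
      (Keeps.valid S.keeping) α-other S.now-miss (S.elsewhere-misses away-v v-miss))
      where
      module S = Switched (switch f-valid α-other β-other α≢β x-miss)
      tip≢x : P.tip ≢ x
      tip≢x = earlier-differs Φ P.here-tip
      away = separated f-valid α≢β (inj₁ v-miss) (inj₂ P.tip-misses) (inj₂ x-miss)
        (joins-distinct (proj₁ (fan-tip P.fan))) (joins-distinct (proj₁ (fan-tip Φ))) tip≢x v~tip
      away-v = proj₁ away
      misses : ∀ {z κ} → (z , κ) ∈ ps → Misses f z κ → Misses S.result z κ
      misses {z} {κ} z∈ miss with κ ℕ.≟ β
      ... | no κ≢β   = S.keeps-misses (α≢seen (∈-map⁺ proj₂ z∈)) κ≢β miss
      ... | yes refl = S.elsewhere-misses (subst (λ y → ¬ Connected f α β x y) (sym (P.only-tip z∈)) (proj₂ away)) miss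

  module _ (f-valid : Valid f) (missed : ∀ z → ∃ λ κ → Other κ × Misses f z κ) where

    open Remove ℕ._≟_ renaming (remove to removeℕ; length-remove to length-removeℕ; ∈-remove to ∈-removeℕ)
    open import Data.List.Membership.DecPropositional ℕ._≟_ using () renaming (_∈?_ to _∈ℕ?_)

    grow-fan : ∀ k (unused : List ℕ) → length unused ≤ k → Fan f v h x e ps →
      (∀ {κ} → Other κ → κ ∈ map proj₂ ps ⊎ κ ∈ unused) → Opened f h
    grow-fan {v = v} {x = x} {ps = ps} k unused len Φ cover with missed x
    ... | β , β-other , x-miss with sees-or-misses f v β
    ... | inj₂ v-miss = open-by-fan ps Φ f-valid β-other x-miss v-miss
    ... | inj₁ (k₁ , z , k₁J , k₁≡β) with β ∈ℕ? map proj₂ ps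
    ... | yes β∈ = open-closed-fan Φ f-valid (proj₁ (proj₂ (missed v))) (proj₂ (proj₂ (missed v))) β-other x-miss β∈
    ... | no β∉ with k | cover β-other
    ... | _     | inj₁ β∈       = contradiction β∈ β∉
    ... | zero  | inj₂ β∈unused = contradiction len (ℕₚ.<⇒≱ (∈-length β∈unused))
    ... | suc k | inj₂ β∈unused =
      grow-fan k (removeℕ β unused) (ℕₚ.≤-pred (ℕₚ.≤-trans (length-removeℕ β∈unused) len))
        (extend Φ β-other x-miss k₁J k₁≡β β∉) λ {κ} κ-other → cover′ κ (cover κ-other)
      where
      cover′ : ∀ κ → κ ∈ map proj₂ ps ⊎ κ ∈ unused → κ ∈ β ∷ map proj₂ ps ⊎ κ ∈ removeℕ β unused
      cover′ κ (inj₁ κ∈) = inj₁ (there κ∈)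
      cover′ κ (inj₂ κ∈) with κ ℕ.≟ β
      ... | yes refl = inj₁ (here refl)
      ... | no κ≢β   = inj₂ (∈-removeℕ κ∈ κ≢β)

    open-edge : Joins h v w → f h ≡ c → Opened f h
    open-edge hJ h-colour = grow-fan _ (range t) ℕₚ.≤-refl (base hJ h-colour)
      λ κ-other → inj₂ (∈-range (proj₁ (proj₁ (proj₁ κ-other))) (proj₂ (proj₁ (proj₁ κ-other))))

  open Remove (_≟_ {m G})

  -- Installing a colour class

  target? : ∀ e → Dec (Target e)
  target? e = g e ℕ.≟ c

  -- The colour 6 joins `others-of-c`, making `c + 1` colours different from `c`.
  missed-other-6 : 5 < t → Valid f → ∀ z → ∃ λ κ → Other κ × Misses f z κ
  missed-other-6 {f} 5<t f-valid z with sees-or-misses f z 6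
  ... | inj₂ miss = 6 , (six-free , λ { refl → ℕₚ.<⇒≱ (s≤s c≤4) (ℕₚ.n≤1+n 5) }) , miss
    where six-free = (s≤s z≤n , 5<t) , inj₂ (ℕₚ.n≤1+n 5)
  ... | inj₁ sees = missed-other-with 6 six-free 6∉ f-valid sees
    where
    six-free = (s≤s z≤n , 5<t) , inj₂ (ℕₚ.n≤1+n 5)
    6∉ : 6 ∉ others-of-c
    6∉ (there 6∈) = ℕₚ.<⇒≱ (s≤s c≤4)
      (ℕₚ.≤-trans (ℕₚ.n≤1+n 5) (ℕₚ.≤-trans (proj₂ (range-≤ 6∈)) ℕₚ.pred[n]≤n))

  gain-from-missing : Valid f → Target e → Joins e u v → Misses f u c → Gain f e
  gain-from-missing {f} {e} {u} {v} f-valid target uv u-miss with sees-or-misses f v c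
  ... | inj₂ v-miss = gain-between-missing f-valid target uv u-miss v-miss
  ... | inj₁ (h , w , hJ , h-colour) with ℕₚ.m≤n⇒m<n∨m≡n 5≤t
  ... | inj₂ 5≡t = FiveColours.gain-at-bad-end (sym 5≡t) record
          { valid = f-valid ; target = target ; uv = uv ; vw = hJ ; h-colour = h-colour ; u-misses = u-miss }
  ... | inj₁ 5<t = gain-after O.reach
          (λ te' → O.keeps λ { refl → e≢h (target-unique (inc₂ uv) (inc₁ hJ) target te') })
          (gain-between-missing O.valid target uv (λ e' i → u-miss e' i ∘ O.reflects) v-misses)
    where
    module O = Opened (open-edge f-valid (missed-other-6 5<t f-valid) hJ h-colour)
    e≢h : e ≢ h
    e≢h refl = u-miss e (inc₁ uv) h-colour
    v-misses : Misses O.result v c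
    v-misses e' i re'≡c = O.opened (subst (λ k → O.result k ≡ c)
      (colour-unique (proper f-valid) i (inc₁ hJ) (trans (O.reflects re'≡c) (sym h-colour))) re'≡c)

  Improvement : Colouring G → Set
  Improvement f = ∃ λ e → Target e × f e ≢ c × Gain f e

  -- If no vertex missing `c` has a badly coloured target, then every vertex misses another colour:
  -- by `missed-other-at-c` if it sees `c`, by `missed-other-if-good` if not. A fan then clears `c`
  -- from one end of `e`.
  improve : Valid f → Target e → f e ≢ c → Improvement f
  improve {f} {e} f-valid target e≢c with any? (λ z → any? λ e' →
    (incident? G z e' ×-dec target? e') ×-dec (¬? (f e' ℕ.≟ c) ×-dec all? λ k → incident? G z k →-dec ¬? (f k ℕ.≟ c)))
  ... | yes (z , e' , (i , te') , e'≢c , z-miss) =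
    e' , te' , e'≢c , gain-from-missing f-valid te' (proj₂ (far-end i)) z-miss
  ... | no none with sees-or-misses f (src G e) c
  ... | inj₂ miss = e , target , e≢c , gain-from-missing f-valid target (inj₁ (refl , refl)) miss
  ... | inj₁ (h , w , hJ , h-colour) = e , target , e≢c , gain-after O.reach
          (λ te' → O.keeps λ { refl → e≢c (trans (cong f (target-unique (inj₁ refl) (inc₁ hJ) target te')) h-colour) })
          (gain-from-missing O.valid target (inj₁ (refl , refl)) u-misses)
    where
    missed : ∀ z → ∃ λ κ → Other κ × Misses f z κ
    missed z with sees-or-misses f z c
    ... | inj₁ sees = missed-other-at-c f-valid sees
    ... | inj₂ miss = missed-other-if-good f-valid λ {e'} i te' →
            decidable-stable (f e' ℕ.≟ c) λ e'≢c → none (z , e' , (i , te') , e'≢c , miss)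
    module O = Opened (open-edge f-valid missed hJ h-colour)
    u-misses : Misses O.result (src G e) c
    u-misses e' i re'≡c = O.opened (subst (λ k → O.result k ≡ c)
      (colour-unique (proper f-valid) i (inc₁ hJ) (trans (O.reflects re'≡c) (sym h-colour))) re'≡c)

  colour-targets : ∀ k (todo : List E) → length todo ≤ k → Valid f →
    (∀ {e} → Target e → f e ≢ c → e ∈ todo) →
    ∃ λ f₁ → Valid f₁ × f ⇝ f₁ × (∀ {e} → Target e → f₁ e ≡ c)
  colour-targets {f} k todo len f-valid cover with any? (λ e → target? e ×-dec ¬? (f e ℕ.≟ c))
  ... | no none = f , f-valid , ε , λ {e} te → decidable-stable (f e ℕ.≟ c) λ e≢c → none (e , te , e≢c)
  ... | yes (_ , te₀ , e₀≢c) with k | improve f-valid te₀ e₀≢c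
  ... | zero  | e , te , e≢c , γ = contradiction len (ℕₚ.<⇒≱ (∈-length (cover te e≢c)))
  ... | suc k | e , te , e≢c , γ =
    let f₁ , f₁-valid , reach , good = colour-targets k (remove e todo)
          (ℕₚ.≤-pred (ℕₚ.≤-trans (length-remove (cover te e≢c)) len)) (Gain.valid γ)
          (λ te' e'≢c → ∈-remove (cover te' (e'≢c ∘ Gain.keeps γ te')) λ { refl → e'≢c (Gain.gained γ) })
    in f₁ , f₁-valid , Gain.reach γ ◅◅ reach , good

  -- With all targets coloured `c`, every vertex satisfies `missed-other-if-good`, so fans are
  -- available everywhere.
  uncolour-others : ∀ k (todo : List E) → length todo ≤ k → Valid f →
    (∀ {e} → Target e → f e ≡ c) → (∀ {e} → ¬ Target e → f e ≡ c → e ∈ todo) →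
    ∃ λ f₁ → Valid f₁ × f ⇝ f₁ × (∀ {e} → Target e → f₁ e ≡ c) × (∀ {e} → f₁ e ≡ c → Target e)
  uncolour-others {f} k todo len f-valid good cover with any? (λ e → ¬? (target? e) ×-dec (f e ℕ.≟ c))
  ... | no none = f , f-valid , ε , good , λ {e} e≡c → decidable-stable (target? e) λ ¬te → none (e , ¬te , e≡c)
  ... | yes (h , h-off , h-colour) with k
  ... | zero  = contradiction len (ℕₚ.<⇒≱ (∈-length (cover h-off h-colour)))
  ... | suc k =
    let f₁ , f₁-valid , reach , good₁ , exact = uncolour-others k (remove h todo)
          (ℕₚ.≤-pred (ℕₚ.≤-trans (length-remove (cover h-off h-colour)) len)) O.valid
          (λ te → O.keeps (λ { refl → h-off te }) (good te))
          (λ ¬te e≡c → ∈-remove (cover ¬te (O.reflects e≡c)) λ { refl → O.opened e≡c })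
    in f₁ , f₁-valid , O.reach ◅◅ reach , good₁ , exact
    where
    module O = Opened (open-edge f-valid (λ z → missed-other-if-good f-valid λ _ → good)
                        (inj₁ (refl , refl)) h-colour)

  match-class : Valid f →
    ∃ λ f₁ → Valid f₁ × f ⇝ f₁ × (∀ {e} → Target e → f₁ e ≡ c) × (∀ {e} → f₁ e ≡ c → Target e)
  match-class f-valid =
    let f₁ , f₁-valid , reach₁ , good = colour-targets _ (allFin (m G)) ℕₚ.≤-refl f-valid (λ {e} _ _ → ∈-allFin e)
        f₂ , f₂-valid , reach₂ , exact = uncolour-others _ (allFin (m G)) ℕₚ.≤-refl f₁-valid good (λ {e} _ _ → ∈-allFin e)
    in f₂ , f₂-valid , reach₁ ◅◅ reach₂ , exact

-- Downward induction over the colour classes of `g`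

match-classes : (G : Graph) (g : Colouring G) (g-proper : ProperEdgeColouring G 4 g) (t : ℕ) (5≤t : 5 ≤ t)
  (c : ℕ) (1≤c : 1 ≤ c) (c≤4 : c ≤ 4) {f : Colouring G} →
  Stage.Valid G g g-proper t c 5≤t 1≤c c≤4 f → Transformable G t f g
match-classes G g g-proper t 5≤t (suc zero) 1≤c c≤4 {f} f-valid =
  f₁ , reach , λ e → agrees e (colours f₁-valid e)
  where
  open Stage G g g-proper t 1 5≤t 1≤c c≤4
  matched = match-class f-valid
  f₁ = proj₁ matched
  f₁-valid = proj₁ (proj₂ matched)
  reach = proj₁ (proj₂ (proj₂ matched))
  agrees : ∀ e → (g e ≤ 1 × Free (f₁ e)) ⊎ (1 < g e × f₁ e ≡ g e) → f₁ e ≡ g e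
  agrees e (inj₂ (_ , f₁e≡ge)) = f₁e≡ge
  agrees e (inj₁ (ge≤1 , _)) =
    trans (proj₁ (proj₂ (proj₂ (proj₂ matched))) ge≡1) (sym ge≡1)
    where ge≡1 = ℕₚ.≤-antisym ge≤1 (g-positive e)
match-classes G g g-proper t 5≤t (suc (suc c)) 1≤c c≤4 {f} f-valid =
  let h , reach′ , agrees = match-classes G g g-proper t 5≤t (suc c) (s≤s z≤n) c+1≤4
        (record { proper = proper f₁-valid ; colours = λ e → next e (g e ℕ.≟ 2 ℕ.+ c) (colours f₁-valid e) })
  in h , reach ◅◅ reach′ , agrees
  where
  open Stage G g g-proper t (2 ℕ.+ c) 5≤t 1≤c c≤4
  c+1≤4 = ℕₚ.≤-trans (ℕₚ.n≤1+n (suc c)) c≤4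
  module Next = Stage G g g-proper t (suc c) 5≤t (s≤s z≤n) c+1≤4
  matched = match-class f-valid
  f₁ = proj₁ matched
  f₁-valid = proj₁ (proj₂ matched)
  reach = proj₁ (proj₂ (proj₂ matched))
  good = proj₁ (proj₂ (proj₂ (proj₂ matched)))
  exact = proj₂ (proj₂ (proj₂ (proj₂ matched)))
  -- Both directions of the match are used: targets become frozen by `good`, and by `exact` no other
  -- edge still has the colour that is no longer free.
  next : ∀ e → Dec (g e ≡ 2 ℕ.+ c) → (g e ≤ 2 ℕ.+ c × Free (f₁ e)) ⊎ (2 ℕ.+ c < g e × f₁ e ≡ g e) →
    (g e ≤ suc c × Next.Free (f₁ e)) ⊎ (suc c < g e × f₁ e ≡ g e)
  next e (yes ge≡c) _ = inj₂ (ℕₚ.≤-reflexive (sym ge≡c) , trans (good ge≡c) (sym ge≡c))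
  next e (no ge≢c) (inj₂ (c<ge , f₁e≡ge)) = inj₂ (ℕₚ.<⇒≤ c<ge , f₁e≡ge)
  next e (no ge≢c) (inj₁ (ge≤c , bounds , small-or-large)) =
    inj₁ (ℕₚ.≤-pred (ℕₚ.≤∧≢⇒< ge≤c ge≢c) , bounds
         , Sum.map₁ (λ f₁e≤c → ℕₚ.≤-pred (ℕₚ.≤∧≢⇒< f₁e≤c (ge≢c ∘ exact))) small-or-large)

theorem1p3 : (G : Graph) → Class1 G → MaxDegree G 4 → (t : ℕ) → t ≥ 5 →
    (f g : Colouring G) → ProperEdgeColouring G t f → ProperEdgeColouring G 4 g →
    Transformable G t f g
theorem1p3 G _ _ t 5≤t f g (f-bounds , f-proper) g-proper =
  match-classes G g g-proper t 5≤t 4 (s≤s z≤n) ℕₚ.≤-refl record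
    { proper = f-proper
    -- At stage 4 nothing is frozen: all `g`-colours are at most 4 and all colours up to `t` are
    -- free.
    ; colours = λ e → inj₁ (proj₂ (proj₁ g-proper e) , f-bounds e , ℕₚ.≤-<-connex (f e) 4) }
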